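{- Let $r$ be a positive integer, let $A$ be a finite set of $k \geq 6$ positive integers, and let $H$ be a set of $t \geq 2$ positive integers with $1 \leq r \leq \max(H) \leq (k-1)r-1$. If \[ |H^{(r)}A| = \mathcal{L}_k(H,r), \] then $H$ is an arithmetic progression with common difference $d \leq r$ and $A$ is an arithmetic progression with common difference $d\cdot \min(A)$.
   Context: For a finite set $A=\{a_1,\ldots,a_k\}$ of integers and positive integers $h, r$, $h^{(r)}A=\{\sum_{i=1}^k \lambda_i a_i : 0\le \lambda_i\le r,\ \sum_{i=1}^k\lambda_i=h\}$, and for a finite set $H$ of positive integers, $H^{(r)}A=\bigcup_{h\in H} h^{(r)}A$. For a set $H=\{h_1<\cdots<h_t\}$ of positive integers, a positive integer $r$ and an integer $k$, put $h_0=0$ and, for $0\le i\le t$, write $h_i=m_i r+\epsilon_i$ with $m_i=\lfloor h_i/r\rfloor$, $0\le \epsilon_i\le r-1$. Define \[\mathcal{L}_k(H,r)=\sum_{i=1}^{t}\Big( r(m_i-m_{i-1})(k-m_i)+(\epsilon_i-\epsilon_{i-1})(k-m_i-1)-\max\{\epsilon_i,\epsilon_{i-1}\}(m_i-m_{i-1})+1\Big).\] A set is an arithmetic progression with common difference $d$ if it has the form $\{a, a+d, \ldots, a+(n-1)d\}$. -}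

module Defs where

open import Data.Nat as ℕ using (ℕ; zero; suc; _+_; _*_; _∸_; _≤_; _<_; _⊓_; _⊔_; NonZero; _≟_)
open import Data.Nat.DivMod using (_/_; _%_)
open import Data.Integer as ℤ using (ℤ; +_)
open import Data.List using (List; []; _∷_; length; map; concatMap; upTo; foldr; deduplicate)
open import Data.List.Membership.Propositional using (_∈_)
open import Data.Product using (∃; ∃-syntax; _×_)
open import Function.Bundles using (_⇔_)
open import Relation.Binary.PropositionalEquality using (_≡_)

-- Finite sets of natural numbers are represented by lists; the statement
-- additionally requires them to be strictly increasing (hence duplicate free).

card : List ℕ → ℕ
card xs = length (deduplicate _≟_ xs)

-- All sums  Σ λᵢ aᵢ  with 0 ≤ λᵢ ≤ r and Σ λᵢ = h  (with repetitions),
-- obtained by enumerating all coefficient choices λ for the elements of the list.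
sumsList : (r h : ℕ) → List ℕ → List ℕ
sumsList r zero    []       = 0 ∷ []
sumsList r (suc h) []       = []
sumsList r h       (a ∷ as) =
  concatMap (λ l → map (λ s → l * a + s) (sumsList r (h ∸ l) as)) (upTo (suc (r ⊓ h)))

restrictedSumset : (H : List ℕ) (r : ℕ) (A : List ℕ) → List ℕ
restrictedSumset H r A = concatMap (λ h → sumsList r h A) H

listMax : List ℕ → ℕ
listMax = foldr _⊔_ 0

listMin : List ℕ → ℕ
listMin []       = 0
listMin (x ∷ xs) = foldr _⊓_ x xs

Lterm : (k r : ℕ) .{{_ : NonZero r}} → (hp h : ℕ) → ℤ
Lterm k r hp h =
    (+ r) ℤ.* (m ℤ.- m') ℤ.* (+ k ℤ.- m)
  ℤ.+ (e ℤ.- e') ℤ.* (+ k ℤ.- m ℤ.- + 1)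
  ℤ.- (+ ((h % r) ⊔ (hp % r))) ℤ.* (m ℤ.- m')
  ℤ.+ + 1
  where
  m  = + (h / r)
  m' = + (hp / r)
  e  = + (h % r)
  e' = + (hp % r)

Lsum : (k r : ℕ) .{{_ : NonZero r}} → (prev : ℕ) → List ℕ → ℤ
Lsum k r prev []       = + 0
Lsum k r prev (h ∷ hs) = Lterm k r prev h ℤ.+ Lsum k r h hs

-- 𝓛_k(H,r) for H = h₁ < ⋯ < h_t given as an increasing list, with h₀ = 0.
𝓛 : (k : ℕ) (H : List ℕ) (r : ℕ) .{{_ : NonZero r}} → ℤ
𝓛 k H r = Lsum k r 0 H

IsAP : (d : ℕ) → List ℕ → Set
IsAP d xs = ∃[ a ] ∃[ n ] (∀ x → (x ∈ xs) ⇔ (∃[ i ] (i < n × x ≡ a + i * d)))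

{-# OPTIONS --safe #-}
module Submission where

-- Write A = {a₀ < ⋯ < aₖ₋₁} and describe a choice of summands by the function P, where P j counts
-- the summands of index ≥ j.  With g 0 = a₀ and g j = aⱼ - aⱼ₋₁ its sum is Σ g j · P j, and the
-- admissible P with P 0 = h form a distributive lattice in which one climbs from the lowest
-- element to the highest by raising one value P j (j ≥ 1) at a time, each step increasing the sum
-- by g j.  Climbing to the top for h₁, then adding the h₂ - h₁ smallest summands, climbing to the
-- top for h₂, and so on gives a chain of at least 𝓛 k H r sums.  So if |H^(r)A| = 𝓛 k H r, then no
-- chain is longer, and two consecutive steps that can be exchanged must have the same size.
-- Exchanging steps suitably shows that every jump hᵢ - hᵢ₋₁ is at most r, and that all gaps g j
-- with j ≥ 1 equal (hᵢ - hᵢ₋₁) · a₀ for every i.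

open import Defs
open import Data.Nat using (ℕ; zero; suc; _+_; _*_; _∸_; _⊓_; _⊔_; _≤_; _<_; z≤n; s≤s; NonZero; >-nonZero; _≟_; _≤?_; _<?_)
open import Data.Nat.Properties
open import Data.Nat.DivMod using (_/_; _%_; m≡m%n+[m/n]*n; m%n<n)
open import Data.Nat.Tactic.RingSolver using (solve-∀)
open import Data.Fin using (Fin; zero; suc)
open import Data.Fin.Properties using (injective⇒≤)
open import Data.List using (List; []; _∷_; length; lookup; deduplicate; map; concatMap; upTo; foldr)
open import Data.List.Membership.Propositional using (_∈_; lose)
open import Data.List.Membership.Propositional.Properties using (∈-deduplicate⁺; ∈-concatMap⁺; ∈-map⁺; ∈-upTo⁺)
open import Data.List.Relation.Unary.All as All using (All; []; _∷_)
open import Data.List.Relation.Unary.Any using (here; there; index)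
open import Data.List.Relation.Unary.Any.Properties using (lookup-index)
open import Data.List.Relation.Unary.Linked as Linked using (Linked; []; [-]; _∷_)
open import Data.List.Relation.Unary.Linked.Properties using (Linked⇒All)
open import Data.Product using (∃-syntax; _×_; _,_; proj₁; proj₂)
open import Data.Sum using (_⊎_; inj₁; inj₂)
open import Function using (_∘_; id)
open import Function.Bundles using (mk⇔)
open import Relation.Binary.Definitions using (tri<; tri≈; tri>)
open import Relation.Binary.PropositionalEquality using (_≡_; _≢_; _≗_; refl; sym; trans; cong; cong₂; subst; subst₂; module ≡-Reasoning)
open import Relation.Nullary using (¬_; Dec; yes; no; contradiction)

-- Exchanges are possible because the length of the chain does not depend on the moment of a jump:
-- it may start from any reachable state `S` for which `S ∔ low Δ` is valid, and the raises omitted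
-- before it are made up afterwards. The first jump can be made from states that avoid index 0 and
-- so have room for Δ new copies of it; there it trades places with any raise at an index of at
-- least 2. Index 1 is the obstacle, as raising it uses up a copy of index 0; its gap is compared
-- with another gap after the jump instead. At a later jump the chain walked so far is fixed, which
-- leaves less freedom. One swap just below the top still yields a single index `J` with
-- `g J ≡ σ (low Δ)`, and this is enough once all gaps are known. That swap also has to precede the
-- study of the first jump, because it helps to exclude `Δ > r`, where the new summands would not
-- all have index 0.

+-left-comm : ∀ a b c → a + (b + c) ≡ b + (a + c)
+-left-comm = solve-∀

-- Reduces a linear inequality to a ring identity with slack `s`. The comparisons of chain lengths
-- called `arith` end this way.
≤-certificate : ∀ {a b c d} s → a ≤ b → c + b + s ≡ d + a → c ≤ d
≤-certificate {a} {b} {c} {d} s a≤b eq = +-cancelʳ-≤ b c d (begin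
  c + b      ≤⟨ m≤m+n (c + b) s ⟩
  c + b + s  ≡⟨ eq ⟩
  d + a      ≤⟨ +-monoʳ-≤ d a≤b ⟩
  d + b      ∎)
  where open ≤-Reasoning

+-∸-≤ : ∀ a b c → (a + b) ∸ c ≤ a + (b ∸ c)
+-∸-≤ a b c = m≤n+o⇒m∸n≤o (a + b) c (begin
  a + b              ≤⟨ +-monoʳ-≤ a (m≤n+m∸n b c) ⟩
  a + (c + (b ∸ c))  ≡⟨ +-left-comm a c (b ∸ c) ⟩
  c + (a + (b ∸ c))  ∎)
  where
  open ≤-Reasoning

+-≡-split : ∀ {a b c d} → a ≤ b → c ≤ d → a + c ≡ b + d → a ≡ b × c ≡ d
+-≡-split {a} {b} {c} {d} a≤b c≤d eq = a≡b , +-cancelˡ-≡ b c d (trans (cong (_+ c) (sym a≡b)) eq)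
  where
  a≡b : a ≡ b
  a≡b = ≤-antisym a≤b (+-cancelʳ-≤ d b a (≤-trans (≤-reflexive (sym eq)) (+-monoʳ-≤ a c≤d)))

-- Functions on the indices: pointwise order, weighted sums, raising one value.

infix 4 _≤̇_
infixl 6 _∔_

_≤̇_ : (ℕ → ℕ) → (ℕ → ℕ) → Set
P ≤̇ Q = ∀ j → P j ≤ Q j

_∔_ : (ℕ → ℕ) → (ℕ → ℕ) → ℕ → ℕ
(P ∔ Q) j = P j + Q j

ones : ℕ → ℕ
ones _ = 1

dot : ℕ → (ℕ → ℕ) → (ℕ → ℕ) → ℕ
dot zero    g P = 0
dot (suc n) g P = g 0 * P 0 + dot n (g ∘ suc) (P ∘ suc)

dot-mono : ∀ n g {P Q} → P ≤̇ Q → dot n g P ≤ dot n g Q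
dot-mono zero    g P≤Q = z≤n
dot-mono (suc n) g P≤Q = +-mono-≤ (*-monoʳ-≤ (g 0) (P≤Q 0)) (dot-mono n (g ∘ suc) (P≤Q ∘ suc))

dot-∔ : ∀ n g P Q → dot n g (P ∔ Q) ≡ dot n g P + dot n g Q
dot-∔ zero    g P Q = refl
dot-∔ (suc n) g P Q = trans
  (cong (g 0 * (P 0 + Q 0) +_) (dot-∔ n (g ∘ suc) (P ∘ suc) (Q ∘ suc)))
  (rearrange (g 0) (P 0) (Q 0) (dot n (g ∘ suc) (P ∘ suc)) (dot n (g ∘ suc) (Q ∘ suc)))
  where
  rearrange : ∀ g p q x y → g * (p + q) + (x + y) ≡ g * p + x + (g * q + y)
  rearrange = solve-∀

dot-zero : ∀ n g {P} → (∀ j → P j ≡ 0) → dot n g P ≡ 0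
dot-zero zero    g P≡0 = refl
dot-zero (suc n) g P≡0 = cong₂ _+_ (trans (cong (g 0 *_) (P≡0 0)) (*-zeroʳ (g 0))) (dot-zero n (g ∘ suc) (P≡0 ∘ suc))

dot-≥ : ∀ n g P → 0 < n → g 0 * P 0 ≤ dot n g P
dot-≥ (suc n) g P _ = m≤m+n (g 0 * P 0) _

dot-cong : ∀ n g {P Q} → P ≗ Q → dot n g P ≡ dot n g Q
dot-cong zero    g P≗Q = refl
dot-cong (suc n) g P≗Q = cong₂ _+_ (cong (g 0 *_) (P≗Q 0)) (dot-cong n (g ∘ suc) (P≗Q ∘ suc))

dot-ones-snoc : ∀ n P → dot (suc n) ones P ≡ dot n ones P + P n
dot-ones-snoc zero    P = trans (+-identityʳ (1 * P 0)) (*-identityˡ (P 0))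
dot-ones-snoc (suc n) P = trans (cong (1 * P 0 +_) (dot-ones-snoc n (P ∘ suc))) (sym (+-assoc (1 * P 0) _ _))

-- Order and equal totals force `P` and `Q` to agree on the first `n` indices. Concluding about
-- `dot` avoids function extensionality when a climb arrives at its goal.
dot-rigid : ∀ n g {P Q} → P ≤̇ Q → dot n ones P ≡ dot n ones Q → dot n g P ≡ dot n g Q
dot-rigid zero    g P≤Q eq = refl
dot-rigid (suc n) g P≤Q eq
  with p , q ← +-≡-split (*-monoʳ-≤ 1 (P≤Q 0)) (dot-mono n ones (P≤Q ∘ suc)) eq
  = cong₂ _+_ (cong (g 0 *_) (*-cancelˡ-≡ _ _ 1 p)) (dot-rigid n (g ∘ suc) (P≤Q ∘ suc) q)

dot-<⇒∃< : ∀ n g {P Q} → dot n g P < dot n g Q → ∃[ j ] P j < Q j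
dot-<⇒∃< (suc n) g {P} {Q} lt with P 0 <? Q 0
... | yes p = 0 , p
... | no ¬p
  with j , q ← dot-<⇒∃< n (g ∘ suc) (+-cancelˡ-< (g 0 * Q 0) _ _
                  (≤-<-trans (+-monoˡ-≤ _ (*-monoʳ-≤ (g 0) (≮⇒≥ ¬p))) lt))
  = suc j , q

-- Recursion instead of an equality test lets the values at literal indices compute, as the `refl`s
-- in `gap-1≡gap-3` require.
bump : ℕ → (ℕ → ℕ) → ℕ → ℕ
bump zero    P zero    = suc (P zero)
bump zero    P (suc j) = P (suc j)
bump (suc i) P zero    = P zero
bump (suc i) P (suc j) = bump i (P ∘ suc) j

bump-≡ : ∀ i P → bump i P i ≡ suc (P i)
bump-≡ zero    P = refl
bump-≡ (suc i) P = bump-≡ i (P ∘ suc)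

bump-≢ : ∀ i P {j} → i ≢ j → bump i P j ≡ P j
bump-≢ zero    P {zero}  i≢j = contradiction refl i≢j
bump-≢ zero    P {suc j} i≢j = refl
bump-≢ (suc i) P {zero}  i≢j = refl
bump-≢ (suc i) P {suc j} i≢j = bump-≢ i (P ∘ suc) (i≢j ∘ cong suc)

bump-∔ : ∀ i P Q → bump i P ∔ Q ≗ bump i (P ∔ Q)
bump-∔ zero    P Q zero    = refl
bump-∔ zero    P Q (suc j) = refl
bump-∔ (suc i) P Q zero    = refl
bump-∔ (suc i) P Q (suc j) = bump-∔ i (P ∘ suc) (Q ∘ suc) j

≤̇-bump : ∀ i P → P ≤̇ bump i P
≤̇-bump zero    P zero    = n≤1+n (P 0)
≤̇-bump zero    P (suc j) = ≤-refl
≤̇-bump (suc i) P zero    = ≤-refl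
≤̇-bump (suc i) P (suc j) = ≤̇-bump i (P ∘ suc) j

bump-≤̇ : ∀ i {P Q} → P ≤̇ Q → P i < Q i → bump i P ≤̇ Q
bump-≤̇ i {P} {Q} P≤Q Pi<Qi j with i ≟ j
... | yes refl = ≤-trans (≤-reflexive (bump-≡ i P)) Pi<Qi
... | no  i≢j  = ≤-trans (≤-reflexive (bump-≢ i P i≢j)) (P≤Q j)

dot-bump : ∀ n g {i} P → i < n → dot n g (bump i P) ≡ g i + dot n g P
dot-bump (suc n) g {zero}  P _         = trans (cong (_+ dot n (g ∘ suc) (P ∘ suc)) (*-suc (g 0) (P 0))) (+-assoc (g 0) _ _)
dot-bump (suc n) g {suc i} P (s≤s i<n) = trans
  (cong (g 0 * P 0 +_) (dot-bump n (g ∘ suc) (P ∘ suc) i<n))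
  (+-left-comm (g 0 * P 0) (g (suc i)) (dot n (g ∘ suc) (P ∘ suc)))

-- Increasing chains in a list and the exchange argument.

data Chain (T : List ℕ) : ℕ → ℕ → ℕ → Set where
  [_]   : ∀ {x} → x ∈ T → Chain T 0 x x
  chain : ∀ {n x y z} → x ∈ T → x < y → Chain T n y z → Chain T (suc n) x z

module _ {T : List ℕ} where

  chain-++ : ∀ {m n w x y z} → Chain T m w x → x < y → Chain T n y z → Chain T (suc (m + n)) w z
  chain-++ [ w∈T ]             x<y d = chain w∈T x<y d
  chain-++ (chain w∈T w<x' c) x<y d = chain w∈T w<x' (chain-++ c x<y d)

  chain-join : ∀ {m n x y z} → Chain T m x y → Chain T n y z → Chain T (m + n) x z
  chain-join [ _ ]             d = d
  chain-join (chain x∈T lt c) d = chain x∈T lt (chain-join c d)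

  private
    member : ∀ {n x y} → Chain T n x y → Fin (suc n) → ℕ
    member {x = x} _             zero    = x
    member         (chain _ _ c) (suc i) = member c i

    member∈T : ∀ {n x y} (c : Chain T n x y) i → member c i ∈ T
    member∈T [ x∈T ]          zero    = x∈T
    member∈T (chain x∈T _ _) zero    = x∈T
    member∈T (chain _ _ c)   (suc i) = member∈T c i

    first≤ : ∀ {n x y} (c : Chain T n x y) i → x ≤ member c i
    first≤ [ _ ]           zero    = ≤-refl
    first≤ (chain _ _ _)   zero    = ≤-refl
    first≤ (chain _ x<y c) (suc i) = ≤-trans (<⇒≤ x<y) (first≤ c i)

    member-injective : ∀ {n x y} (c : Chain T n x y) {i j} → member c i ≡ member c j → i ≡ j
    member-injective c               {zero}  {zero}  eq = refl
    member-injective (chain _ x<y c) {zero}  {suc j} eq = contradiction eq (<⇒≢ (<-≤-trans x<y (first≤ c j)))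
    member-injective (chain _ x<y c) {suc i} {zero}  eq = contradiction (sym eq) (<⇒≢ (<-≤-trans x<y (first≤ c i)))
    member-injective (chain _ _ c)   {suc i} {suc j} eq = cong suc (member-injective c eq)

  -- Pigeonhole: the members of a chain occupy pairwise different positions of the deduplicated
  -- list.
  chain-card : ∀ {n x y} → Chain T n x y → suc n ≤ card T
  chain-card c = injective⇒≤ {f = λ i → index (pos i)} λ {i} {j} eq →
    member-injective c (trans (lookup-index (pos i)) (trans (cong (lookup (deduplicate _≟_ T)) eq) (sym (lookup-index (pos j)))))
    where
    pos : ∀ i → member c i ∈ deduplicate _≟_ T
    pos i = ∈-deduplicate⁺ _≟_ (member∈T c i)

  -- Such a chain would have `m + n + 4` members. The index has the shape that `chain-++` produces
  -- in `diamond`.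
  too-long : ∀ {m n w z} → card T ≤ 3 + (m + n) → ¬ Chain T (suc (m + suc (suc n))) w z
  too-long {m} {n} small c = <⇒≱ (chain-card c)
    (≤-trans small (≤-reflexive (cong suc (sym (trans (+-suc m (suc n)) (cong suc (+-suc m n)))))))

  -- If v₁ ≠ v₂, both can be inserted between x and y, which makes a chain longer than T.
  diamond : ∀ {m n w x v₁ v₂ y z} → Chain T m w x → Chain T n y z → card T ≤ 3 + (m + n) →
            v₁ ∈ T → v₂ ∈ T → x < v₁ → v₁ < y → x < v₂ → v₂ < y → v₁ ≡ v₂
  diamond {m} {n} {w} {x} {v₁} {v₂} {y} {z} c d small v₁∈T v₂∈T x<v₁ v₁<y x<v₂ v₂<y with <-cmp v₁ v₂
  ... | tri≈ _ eq _ = eq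
  ... | tri< lt _ _ = contradiction (chain-++ c x<v₁ (chain v₁∈T lt (chain v₂∈T v₂<y d))) (too-long small)
  ... | tri> _ _ lt = contradiction (chain-++ c x<v₂ (chain v₂∈T lt (chain v₁∈T v₁<y d))) (too-long small)

-- The lattice of admissible states.

module States (r : ℕ) (1≤r : 1 ≤ r) where

  -- P j is the number of summands (with multiplicity) of index ≥ j, for indices 0 , … , n - 1.
  record Valid (n : ℕ) (P : ℕ → ℕ) : Set where
    constructor valid
    field
      decreasing : ∀ j → P (suc j) ≤ P j
      bounded    : ∀ j → P j ≤ r + P (suc j)
      vanishing  : P n ≡ 0

  open Valid public

  valid-resp : ∀ {n P Q} → P ≗ Q → Valid n P → Valid n Q
  valid-resp {n} P≗Q V = valid
    (λ j → subst₂ _≤_ (P≗Q (suc j)) (P≗Q j) (decreasing V j))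
    (λ j → subst₂ (λ x y → x ≤ r + y) (P≗Q j) (P≗Q (suc j)) (bounded V j))
    (trans (sym (P≗Q n)) (vanishing V))

  valid-antitone : ∀ {n P} → Valid n P → ∀ {i j} → i ≤ j → P j ≤ P i
  valid-antitone {P = P} V {i} {j} i≤j = subst (λ x → P x ≤ P i) (m∸n+n≡m i≤j) (go (j ∸ i))
    where
    go : ∀ d → P (d + i) ≤ P i
    go zero    = ≤-refl
    go (suc d) = ≤-trans (decreasing V (d + i)) (go d)

  valid-zero : ∀ {n P} → Valid n P → ∀ {j} → n ≤ j → P j ≡ 0
  valid-zero V n≤j = n≤0⇒n≡0 (≤-trans (valid-antitone V n≤j) (≤-reflexive (vanishing V)))

  valid-<⇒< : ∀ {n P} → Valid n P → ∀ {i m} → m < P i → i < n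
  valid-<⇒< {n} V {i} m<Pi with i <? n
  ... | yes i<n = i<n
  ... | no  i≮n = contradiction (valid-zero V (≮⇒≥ i≮n)) (λ eq → <⇒≢ (≤-<-trans z≤n m<Pi) (sym eq))

  -- One summand moves from index `i` to index `suc i`: there must be one at `i`, and `suc i` must
  -- hold fewer than `r`.
  valid-bump : ∀ {n P} → Valid n P → ∀ i → suc i < n → P (suc i) < P i → P (suc i) < r + P (suc (suc i)) →
               Valid n (bump (suc i) P)
  valid-bump {n} {P} V i 1+i<n lt lt′ = valid dec bnd (trans (bump-≢ (suc i) P (<⇒≢ 1+i<n)) (vanishing V))
    where
    B = bump (suc i) P
    dec : ∀ j → B (suc j) ≤ B j
    dec j with suc i ≟ suc j
    ... | yes refl = ≤-trans (≤-reflexive (bump-≡ (suc i) P)) (≤-trans lt (≤̇-bump (suc i) P j))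
    ... | no  i≢j  = ≤-trans (≤-reflexive (bump-≢ (suc i) P i≢j)) (≤-trans (decreasing V j) (≤̇-bump (suc i) P j))
    bnd : ∀ j → B j ≤ r + B (suc j)
    bnd j with suc i ≟ j
    ... | yes refl = ≤-trans (≤-reflexive (bump-≡ (suc i) P)) (≤-trans lt′ (+-monoʳ-≤ r (≤̇-bump (suc i) P (suc j))))
    ... | no  i≢j  = ≤-trans (≤-reflexive (bump-≢ (suc i) P i≢j)) (≤-trans (bounded V j) (+-monoʳ-≤ r (≤̇-bump (suc i) P (suc j))))

  -- The multiplicity of index `j` is `P j - P (suc j)`; if no index occurs in both states, no
  -- multiplicity exceeds `r`.
  valid-∔ : ∀ {n P Z} → Valid n P → Valid n Z → (∀ j → P j ≤ P (suc j) ⊎ Z j ≤ Z (suc j)) → Valid n (P ∔ Z)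
  valid-∔ {n} {P} {Z} V W alt = valid
    (λ j → +-mono-≤ (decreasing V j) (decreasing W j)) bnd (cong₂ _+_ (vanishing V) (vanishing W))
    where
    bnd : ∀ j → P j + Z j ≤ r + (P (suc j) + Z (suc j))
    bnd j with alt j
    ... | inj₁ p = ≤-trans (+-mono-≤ p (bounded W j)) (≤-reflexive (+-left-comm (P (suc j)) r (Z (suc j))))
    ... | inj₂ z = ≤-trans (+-mono-≤ (bounded V j) z) (≤-reflexive (+-assoc r _ _))

  module _ {n P Q} (V : Valid n P) (W : Valid n Q) where

    private
      -- Where `P` is flat, the deficit against the decreasing `Q` passes to the left neighbour; it
      -- cannot reach index 0, where both agree.
      leftmost : P 0 ≡ Q 0 → ∀ j → P j < Q j → ∃[ i ] (P (suc i) < Q (suc i) × P (suc i) < P i)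
      leftmost eq zero    lt = contradiction eq (<⇒≢ lt)
      leftmost eq (suc j) lt with P (suc j) <? P j
      ... | yes p = j , lt , p
      ... | no ¬p = leftmost eq j (≤-<-trans (≮⇒≥ ¬p) (<-≤-trans lt (decreasing W j)))

      -- If index `suc i` already holds `r` summands, the bound on `Q` passes the deficit to the
      -- right, and `1 ≤ r` keeps a summand available to move. The search stops before `n`, where
      -- `Q` vanishes.
      rightmost : ∀ fuel i → n ≤ fuel + suc i → P (suc i) < Q (suc i) → P (suc i) < P i →
                  ∃[ j ] (P (suc j) < Q (suc j) × P (suc j) < P j × P (suc j) < r + P (suc (suc j)))
      rightmost zero       i n≤ lt lt′ = contradiction n≤ (<⇒≱ (valid-<⇒< W lt))
      rightmost (suc fuel) i n≤ lt lt′ with P (suc i) <? r + P (suc (suc i))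
      ... | yes p = i , lt , lt′ , p
      ... | no ¬p = rightmost fuel (suc i) (≤-trans n≤ (≤-reflexive (sym (+-suc fuel (suc i)))))
        (+-cancelˡ-< r _ _ (≤-<-trans (≮⇒≥ ¬p) (<-≤-trans lt (bounded W (suc i)))))
        (≤-trans (+-monoˡ-≤ _ 1≤r) (≮⇒≥ ¬p))

    valid-step : P ≤̇ Q → P 0 ≡ Q 0 → ∀ j → P j < Q j →
                 ∃[ i ] (suc i < n × Valid n (bump (suc i) P) × bump (suc i) P ≤̇ Q)
    valid-step P≤Q eq j lt with leftmost eq j lt
    ... | i , p , q with rightmost n i (m≤m+n n (suc i)) p q
    ... | m , a , b , c = m , valid-<⇒< W a , valid-bump V m (valid-<⇒< W a) b c , bump-≤̇ (suc m) P≤Q a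

  weight : ℕ → (ℕ → ℕ) → ℕ
  weight n = dot n ones

  -- Index `j` has to be raised at some moment on the way to `Q`; `R` is the state just before. `m`
  -- counts the remaining steps.
  climb : ∀ {n} m {P Q} → Valid n P → Valid n Q → P ≤̇ Q → P 0 ≡ Q 0 → weight n Q ≡ m + weight n P →
          ∀ j → P j < Q j → ∃[ R ] (Valid n R × P ≤̇ R × Valid n (bump j R) × bump j R ≤̇ Q)
  climb {n} m {P} {Q} V W P≤Q eq wt j lt with valid-step V W P≤Q eq j lt
  climb {n} zero    {P} {Q} V W P≤Q eq wt j lt | i , i<n , V′ , le =
    contradiction (≤-trans (≤-reflexive (sym (dot-bump n ones P i<n))) (dot-mono n ones le)) (<⇒≱ (s≤s (≤-reflexive wt)))
  climb {n} (suc m) {P} {Q} V W P≤Q eq wt j lt | i , i<n , V′ , le with suc i ≟ j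
  ... | yes refl = P , V , (λ _ → ≤-refl) , V′ , le
  ... | no  i≢j
    with R , VR , B≤R , VR′ , R≤Q ← climb m V′ W le eq
           (trans wt (trans (sym (+-suc m _)) (cong (m +_) (sym (dot-bump n ones P i<n)))))
           j (≤-<-trans (≤-reflexive (bump-≢ (suc i) P i≢j)) lt)
    = R , VR , (λ x → ≤-trans (≤̇-bump (suc i) P x) (B≤R x)) , VR′ , R≤Q

  passes-through : ∀ {n P Q} → Valid n P → Valid n Q → P ≤̇ Q → P 0 ≡ Q 0 →
          ∀ j → P j < Q j → ∃[ R ] (Valid n R × P ≤̇ R × Valid n (bump j R) × bump j R ≤̇ Q)
  passes-through {n} V W P≤Q eq = climb _ V W P≤Q eq (sym (m∸n+n≡m (dot-mono n ones P≤Q)))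

  -- All `h` summands on the smallest indices, `r` at each until they run out; `top` is the mirror
  -- image.
  low : ℕ → ℕ → ℕ
  low h j = h ∸ j * r

  top : ℕ → ℕ → ℕ → ℕ
  top n h j = h ⊓ ((n ∸ j) * r)

  low-valid : ∀ n h → h ≤ n * r → Valid n (low h)
  low-valid n h h≤ = valid
    (λ j → ∸-monoʳ-≤ h (m≤n+m (j * r) r))
    (λ j → m≤n+o⇒m∸n≤o h (j * r) (≤-trans (m≤n+m∸n h (r + j * r)) (≤-reflexive (swap r (j * r) (h ∸ (r + j * r))))))
    (m≤n⇒m∸n≡0 h≤)
    where
    swap : ∀ r x y → r + x + y ≡ x + (r + y)
    swap = solve-∀

  ⊓-bounded : ∀ h {a b} → a ≤ r + b → h ⊓ a ≤ r + h ⊓ b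
  ⊓-bounded h {a} {b} a≤ = ≤-trans (⊓-mono-≤ (m≤n+m h r) a≤) (≤-reflexive (sym (+-distribˡ-⊓ r h b)))

  ∸-suc-*-≤ : ∀ n j → (n ∸ j) * r ≤ r + (n ∸ suc j) * r
  ∸-suc-*-≤ n j = *-monoˡ-≤ r {y = suc (n ∸ suc j)} (m≤n+o⇒m∸n≤o n j (≤-trans (m≤n+m∸n n (suc j)) (≤-reflexive (sym (+-suc j _)))))

  top-valid : ∀ n h → Valid n (top n h)
  top-valid n h = valid
    (λ j → ⊓-monoʳ-≤ h (*-monoˡ-≤ r (∸-monoʳ-≤ n (n≤1+n j))))
    (λ j → ⊓-bounded h (∸-suc-*-≤ n j))
    (trans (cong (λ x → h ⊓ (x * r)) (n∸n≡0 n)) (⊓-zeroʳ h))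

  ≤̇-top : ∀ {n P h} → Valid n P → P 0 ≡ h → P ≤̇ top n h
  ≤̇-top {n} {P} V refl j = ⊓-glb (valid-antitone V z≤n) (cap (n ∸ j) j (m≤n+m∸n n j))
    where
    cap : ∀ d j → n ≤ j + d → P j ≤ d * r
    cap zero    j n≤ = ≤-reflexive (valid-zero V (≤-trans n≤ (≤-reflexive (+-identityʳ j))))
    cap (suc d) j n≤ = ≤-trans (bounded V j) (+-monoʳ-≤ r (cap d (suc j) (≤-trans n≤ (≤-reflexive (+-suc j d)))))

  low-≤̇ : ∀ {n P h} → Valid n P → P 0 ≡ h → low h ≤̇ P
  low-≤̇ {P = P} V refl j = m≤n+o⇒m∸n≤o (P 0) (j * r) (go j)
    where
    go : ∀ j → P 0 ≤ j * r + P j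
    go zero    = ≤-refl
    go (suc j) = ≤-trans (go j) (≤-trans (+-monoʳ-≤ (j * r) (bounded V j)) (≤-reflexive (swap (j * r) r (P (suc j)))))
      where
      swap : ∀ x r p → x + (r + p) ≡ r + x + p
      swap = solve-∀

  top-0 : ∀ n h → h ≤ n * r → top n h 0 ≡ h
  top-0 n h h≤ = m≤n⇒m⊓n≡m h≤

-- Weights of the extreme states and lengths of climbs.

module Weights (r : ℕ) (1≤r : 1 ≤ r) where
  open States r 1≤r

  -- Before the zeros the values form the progression from `q * r + ρ` down to `ρ` with step `r`;
  -- doubling its sum avoids a division.
  weight-low : ∀ q n ρ → q < n → ρ ≤ r → 2 * weight n (low (q * r + ρ)) ≡ suc q * (q * r + 2 * ρ)
  weight-low zero (suc n) ρ _ ρ≤r = trans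
    (cong (λ x → 2 * (1 * ρ + x)) (dot-zero n ones (λ j → m≤n⇒m∸n≡0 (≤-trans ρ≤r (m≤m+n r (j * r))))))
    (tidy ρ)
    where
    tidy : ∀ ρ → 2 * (1 * ρ + 0) ≡ 1 * (0 + 2 * ρ)
    tidy = solve-∀
  weight-low (suc q) (suc n) ρ (s≤s q<n) ρ≤r = begin
    2 * (1 * (suc q * r + ρ) + weight n (λ j → suc q * r + ρ ∸ suc j * r))
      ≡⟨ cong (λ x → 2 * (1 * (suc q * r + ρ) + x)) (dot-cong n ones (λ j →
           trans (cong (_∸ suc j * r) (+-assoc r (q * r) ρ)) ([m+n]∸[m+o]≡n∸o r (q * r + ρ) (j * r)))) ⟩
    2 * (1 * (suc q * r + ρ) + weight n (low (q * r + ρ)))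
      ≡⟨ *-distribˡ-+ 2 (1 * (suc q * r + ρ)) _ ⟩
    2 * (1 * (suc q * r + ρ)) + 2 * weight n (low (q * r + ρ))
      ≡⟨ cong (2 * (1 * (suc q * r + ρ)) +_) (weight-low q n ρ q<n ρ≤r) ⟩
    2 * (1 * (suc q * r + ρ)) + suc q * (q * r + 2 * ρ)
      ≡⟨ tidy q r ρ ⟩
    suc (suc q) * (suc q * r + 2 * ρ) ∎
    where
    open ≡-Reasoning
    tidy : ∀ q r ρ → 2 * (1 * (suc q * r + ρ)) + suc q * (q * r + 2 * ρ) ≡ suc (suc q) * (suc q * r + 2 * ρ)
    tidy = solve-∀

  -- Reflection: index `j` of `top n h` and index `n - j` of `low h` add up to `h`, because
  -- `h ⊓ x + (h ∸ x) = h`. The last `h` is the value of `low h` at 0.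
  weight-top : ∀ n h → h ≤ n * r → weight n (top n h) + weight n (low h) ≡ suc n * h
  weight-top n h h≤nr = begin
    weight n (top n h) + weight n (low h)                ≡⟨ cong (weight n (top n h) +_) shift ⟩
    weight n (top n h) + (h + weight n (low h ∘ suc))    ≡⟨ +-left-comm (weight n (top n h)) h (weight n (low h ∘ suc)) ⟩
    h + (weight n (top n h) + weight n (low h ∘ suc))    ≡⟨ cong (h +_) (complement n) ⟩
    suc n * h                                            ∎
    where
    open ≡-Reasoning
    shift : weight n (low h) ≡ h + weight n (low h ∘ suc)
    shift = begin
      weight n (low h)                     ≡⟨ sym (+-identityʳ _) ⟩
      weight n (low h) + 0                 ≡⟨ cong (weight n (low h) +_) (sym (m≤n⇒m∸n≡0 h≤nr)) ⟩
      weight n (low h) + low h n           ≡⟨ sym (dot-ones-snoc n (low h)) ⟩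
      1 * h + weight n (low h ∘ suc)       ≡⟨ cong (_+ weight n (low h ∘ suc)) (*-identityˡ h) ⟩
      h + weight n (low h ∘ suc)           ∎
    complement : ∀ n → weight n (top n h) + weight n (low h ∘ suc) ≡ n * h
    complement zero    = refl
    complement (suc n) = begin
      1 * top (suc n) h 0 + weight n (top n h) + weight (suc n) (low h ∘ suc)
        ≡⟨ cong (1 * top (suc n) h 0 + weight n (top n h) +_) (dot-ones-snoc n (low h ∘ suc)) ⟩
      1 * top (suc n) h 0 + weight n (top n h) + (weight n (low h ∘ suc) + (h ∸ suc n * r))
        ≡⟨ tidy (top (suc n) h 0) (weight n (top n h)) (weight n (low h ∘ suc)) (h ∸ suc n * r) ⟩
      h ⊓ (suc n * r) + (h ∸ suc n * r) + (weight n (top n h) + weight n (low h ∘ suc))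
        ≡⟨ cong₂ _+_ (trans (cong (_+ (h ∸ suc n * r)) (⊓-comm h (suc n * r))) (m⊓n+n∸m≡n (suc n * r) h)) (complement n) ⟩
      suc n * h ∎
      where
      tidy : ∀ a b c d → 1 * a + b + (c + d) ≡ a + d + (b + c)
      tidy = solve-∀

  -- If the new summands use index `j`, then `j * r < Δ`, hence `hp ≤ (n - j) * r` and the old ones
  -- fit on the indices above `j`. So the two states share no index.
  top∔low-valid : ∀ n hp Δ → hp + Δ ≤ n * r → Valid (suc n) (top (suc n) hp ∔ low Δ)
  top∔low-valid n hp Δ h≤nr = valid-∔ (top-valid (suc n) hp)
    (low-valid (suc n) Δ (≤-trans (m≤n+m Δ hp) (≤-trans h≤nr (m≤n+m (n * r) r)))) alt
    where
    alt : ∀ j → top (suc n) hp j ≤ top (suc n) hp (suc j) ⊎ low Δ j ≤ low Δ (suc j)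
    alt j with Δ ≤? j * r
    ... | yes Δ≤jr = inj₂ (≤-trans (≤-reflexive (m≤n⇒m∸n≡0 Δ≤jr)) z≤n)
    ... | no  Δ≰jr = inj₁ (≤-trans (m⊓n≤m hp _) (⊓-glb ≤-refl (≤-trans
            (m+n≤o⇒m≤o∸n hp (≤-trans (+-monoʳ-≤ hp (≰⇒≥ Δ≰jr)) h≤nr))
            (≤-reflexive (sym (*-distribʳ-∸ r n j))))))

  -- The number of raises from the state just after the jump to the next top; by `rise-+` the
  -- truncated subtraction is exact.
  rise : ℕ → ℕ → ℕ → ℕ
  rise n hp h = weight n (top n h) ∸ (weight n (top n hp) + weight n (low (h ∸ hp)))

  rise-+ : ∀ n hp Δ → hp + Δ ≤ n * r →
    rise (suc n) hp (hp + Δ) + (weight (suc n) (top (suc n) hp) + weight (suc n) (low Δ)) ≡ weight (suc n) (top (suc n) (hp + Δ))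
  rise-+ n hp Δ h≤nr = trans
    (cong (λ x → w (top (suc n) (hp + Δ)) ∸ (w (top (suc n) hp) + w (low x)) + (w (top (suc n) hp) + w (low Δ))) (m+n∸m≡n hp Δ))
    (m∸n+n≡m (≤-trans (≤-reflexive (sym (dot-∔ (suc n) ones (top (suc n) hp) (low Δ))))
      (dot-mono (suc n) ones (≤̇-top (top∔low-valid n hp Δ h≤nr)
        (cong (_+ Δ) (top-0 (suc n) hp (≤-trans (≤-trans (m≤m+n hp Δ) h≤nr) (m≤n+m (n * r) r))))))))
    where
    w : (ℕ → ℕ) → ℕ
    w = weight (suc n)

  -- The `suc` is the step of the jump. For `hp = 0` the first jump leaves from the empty sum, which
  -- is not in the chain, so the value then counts members instead of steps.
  climbs : ℕ → ℕ → List ℕ → ℕ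
  climbs n hp []       = 0
  climbs n hp (h ∷ hs) = suc (rise (suc n) hp h) + climbs n h hs

-- Exchanges in a chain of maximal length.

module Extremal (r : ℕ) (1≤r : 1 ≤ r) (k′ : ℕ) (g : ℕ → ℕ) (g-pos : ∀ {j} → j < suc k′ → 1 ≤ g j)
  (H T : List ℕ) (sum∈T : ∀ {P} → States.Valid r 1≤r (suc k′) P → P 0 ∈ H → dot (suc k′) g P ∈ T) where

  open States r 1≤r
  open Weights r 1≤r

  k : ℕ
  k = suc k′

  w σ : (ℕ → ℕ) → ℕ
  w = weight k
  σ = dot k g

  σ-bump : ∀ {i} P → i < k → σ (bump i P) ≡ g i + σ P
  σ-bump = dot-bump k g

  w-bump : ∀ {i} P → i < k → w (bump i P) ≡ suc (w P)
  w-bump = dot-bump k ones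

  σ-<-bump : ∀ {i} P → i < k → σ P < σ (bump i P)
  σ-<-bump P i<k = ≤-trans (+-monoˡ-≤ (σ P) (g-pos i<k)) (≤-reflexive (sym (σ-bump P i<k)))

  σ-pos : ∀ {P} → 1 ≤ P 0 → 1 ≤ σ P
  σ-pos {P} 1≤P0 = ≤-trans (*-mono-≤ (g-pos (s≤s z≤n)) 1≤P0) (m≤m+n (g 0 * P 0) _)

  σ-<-jump : ∀ S {Δ} → 1 ≤ Δ → σ S < σ (S ∔ low Δ)
  σ-<-jump S {Δ} 1≤Δ = ≤-trans (+-monoˡ-≤ (σ S) (σ-pos {low Δ} 1≤Δ))
    (≤-reflexive (trans (+-comm (σ (low Δ)) (σ S)) (sym (dot-∔ k g S (low Δ)))))

  -- Each raise adds 1 to the weight, so every path from `P` to `Q` has the same length.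
  ascend : ∀ {h P Q} → h ∈ H → Valid k P → Valid k Q → P 0 ≡ h → Q 0 ≡ h → P ≤̇ Q →
           ∃[ n ] (Chain T n (σ P) (σ Q) × n + w P ≡ w Q)
  ascend {h} {P₀} {Q} h∈H VP VQ P0 Q0 P≤Q =
    w Q ∸ w P₀ , go (w Q ∸ w P₀) VP P0 P≤Q (sym weights) , weights
    where
    weights : w Q ∸ w P₀ + w P₀ ≡ w Q
    weights = m∸n+n≡m (dot-mono k ones P≤Q)

    in-T : ∀ {P} → Valid k P → P 0 ≡ h → σ P ∈ T
    in-T V eq = sum∈T V (subst (_∈ H) (sym eq) h∈H)

    go : ∀ m {P} → Valid k P → P 0 ≡ h → P ≤̇ Q → w Q ≡ m + w P → Chain T m (σ P) (σ Q)
    go zero    V P0 P≤Q wt = subst (Chain T 0 _) (dot-rigid k g P≤Q (sym wt)) [ in-T V P0 ]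
    go (suc m) {P} V P0 P≤Q wt
      with j , lt ← dot-<⇒∃< k ones {P} {Q} (≤-trans (s≤s (m≤n+m (w P) m)) (≤-reflexive (sym wt)))
      with i , i<k , V′ , le ← valid-step V VQ P≤Q (trans P0 (sym Q0)) j lt
      = chain (in-T V P0) (σ-<-bump P i<k)
          (go m V′ P0 le (trans wt (trans (sym (+-suc m (w P))) (cong (m +_) (sym (w-bump P i<k))))))

  -- The fixed parts of the chain end at `M`, which contains index 0, and resume at the top for `h`.
  -- `small` says that linking them by raises and one jump exhausts `T`; the weight of the state
  -- from which the jump starts has cancelled, so that state stays free.
  module Jump (h′ Δ : ℕ) (hp∈H : suc h′ ∈ H) (h∈H : suc h′ + Δ ∈ H) (1≤Δ : 1 ≤ Δ) (h<k′r : suc h′ + Δ < k′ * r)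
    (M : ℕ → ℕ) (VM : Valid k M) (M0 : M 0 ≡ suc h′) (M1 : M 1 < suc h′)
    {p s u z : ℕ} (prefix : Chain T p s (σ M)) (suffix : Chain T u (σ (top k (suc h′ + Δ))) z)
    (small : card T + (w M + w (low Δ)) ≤ 2 + (p + u + w (top k (suc h′ + Δ)))) where

    private
      hp h : ℕ
      hp = suc h′
      h  = hp + Δ

    h≤kr : h ≤ k * r
    h≤kr = ≤-trans (<⇒≤ h<k′r) (m≤n+m (k′ * r) r)

    reach : ∀ {S} → Valid k S → S 0 ≡ hp → M ≤̇ S → ∃[ n ] (Chain T n s (σ S) × n + w M ≡ p + w S)
    reach V S0 M≤S with n , c , eq ← ascend hp∈H VM V M0 S0 M≤S =
      p + n , chain-join prefix c , trans (+-assoc p n (w M)) (cong (p +_) eq)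

    finish : ∀ {S} → Valid k S → S 0 ≡ h → ∃[ n ] (Chain T n (σ S) z × n + w S ≡ w (top k h) + u)
    finish {S} V S0 with n , c , eq ← ascend h∈H V (top-valid k h) S0 (top-0 k h h≤kr) (≤̇-top V S0) =
      n + u , chain-join c suffix , trans (swap n u (w S)) (cong (_+ u) eq)
      where
      swap : ∀ n u x → n + u + x ≡ n + x + u
      swap = solve-∀

    -- Raise then jump, or jump then raise: both lead from `S` to the same state, so `diamond`
    -- identifies the two intermediate sums.
    commute-jump : ∀ {S j} → Valid k S → S 0 ≡ hp → M ≤̇ S → suc j < k → Valid k (bump (suc j) S) →
                   Valid k (S ∔ low Δ) → Valid k (bump (suc j) (S ∔ low Δ)) → g (suc j) ≡ σ (low Δ)
    commute-jump {S} {j} V S0 M≤S j<k V₁ V₂ V₃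
      with n , c , eq ← reach V S0 M≤S
      with m , d , eq′ ← finish V₃ (cong (_+ Δ) S0)
      = +-cancelʳ-≡ (σ S) (g (suc j)) (σ (low Δ)) (begin
          g (suc j) + σ S      ≡⟨ sym (σ-bump S j<k) ⟩
          σ (bump (suc j) S)   ≡⟨ diamond c d few
                                    (sum∈T V₁ (subst (_∈ H) (sym S0) hp∈H))
                                    (sum∈T V₂ (subst (_∈ H) (sym (cong (_+ Δ) S0)) h∈H))
                                    (σ-<-bump S j<k) b<d (σ-<-jump S 1≤Δ) (σ-<-bump (S ∔ low Δ) j<k) ⟩
          σ (S ∔ low Δ)        ≡⟨ dot-∔ k g S (low Δ) ⟩
          σ S + σ (low Δ)      ≡⟨ +-comm (σ S) (σ (low Δ)) ⟩
          σ (low Δ) + σ S      ∎)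
      where
      open ≡-Reasoning
      X = S ∔ low Δ
      b<d : σ (bump (suc j) S) < σ (bump (suc j) X)
      b<d = subst₂ _<_ (sym (σ-bump S j<k)) (sym (σ-bump X j<k)) (+-monoʳ-< (g (suc j)) (σ-<-jump S 1≤Δ))
      -- `a`, `b`, `l` and `S` are the weights of `M`, `top k h`, `low Δ` and the state `S`; the
      -- last one cancels.
      arith : ∀ N n m p u a b l S → n + a ≡ p + S → m + suc (S + l) ≡ b + u →
              N + (a + l) ≤ 2 + (p + u + b) → N ≤ 3 + (n + m)
      arith N n m p u a b l S e₁ e₂ le = ≤-certificate 0 le (trans
        (lhs N p u b)
        (trans (cong₂ (λ x y → 2 + N + x + y) refl (sym e₂))
        (trans (mid N p m S l) (trans (cong (λ x → 3 + (m + N) + x + l) (sym e₁)) (rhs N n m a l)))))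
        where
        lhs : ∀ N p u b → N + (2 + (p + u + b)) + 0 ≡ 2 + N + p + (b + u)
        lhs = solve-∀
        mid : ∀ N p m S l → 2 + N + p + (m + suc (S + l)) ≡ 3 + (m + N) + (p + S) + l
        mid = solve-∀
        rhs : ∀ N n m a l → 3 + (m + N) + (n + a) + l ≡ 3 + (n + m) + (N + (a + l))
        rhs = solve-∀
      few : card T ≤ 3 + (n + m)
      few = arith (card T) n m p u (w M) (w (top k h)) (w (low Δ)) (w S) eq
        (trans (cong (m +_) (sym (trans (w-bump X j<k) (cong suc (dot-∔ k ones S (low Δ)))))) eq′) small

    -- The same square with two raises, at a state `X` reached after jumping from `S`.
    commute-moves : ∀ {S X i j} → Valid k S → S 0 ≡ hp → M ≤̇ S → Valid k (S ∔ low Δ) → S ∔ low Δ ≤̇ X →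
                    X 0 ≡ h → suc i < k → suc j < k → Valid k X → Valid k (bump (suc i) X) → Valid k (bump (suc j) X) →
                    Valid k (bump (suc i) (bump (suc j) X)) → g (suc i) ≡ g (suc j)
    commute-moves {S} {X} {i} {j} V S0 M≤S VJ J≤X X0 i<k j<k VX V₁ V₂ V₃
      with n , c , eq ← reach V S0 M≤S
      with q , e , eq″ ← ascend h∈H VJ VX (cong (_+ Δ) S0) X0 J≤X
      with m , d , eq′ ← finish V₃ X0
      = +-cancelʳ-≡ (σ X) (g (suc i)) (g (suc j)) (trans (sym (σ-bump X i<k)) (trans
          (diamond (chain-++ c (σ-<-jump S 1≤Δ) e) d few
            (sum∈T V₁ (subst (_∈ H) (sym X0) h∈H)) (sum∈T V₂ (subst (_∈ H) (sym X0) h∈H))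
            (σ-<-bump X i<k) i<ij (σ-<-bump X j<k) (σ-<-bump (bump (suc j) X) i<k))
          (σ-bump X j<k)))
      where
      i<ij : σ (bump (suc i) X) < σ (bump (suc i) (bump (suc j) X))
      i<ij = subst₂ _<_ (sym (σ-bump X i<k)) (sym (σ-bump (bump (suc j) X) i<k)) (+-monoʳ-< (g (suc i)) (σ-<-bump X j<k))
      arith : ∀ N n m q p u a b l S X → n + a ≡ p + S → q + (S + l) ≡ X → m + suc (suc X) ≡ b + u →
              N + (a + l) ≤ 2 + (p + u + b) → N ≤ 3 + (suc (n + q) + m)
      arith N n m q p u a b l S X e₁ refl e₂ le = ≤-certificate 0 le (trans
        (lhs N p u b)
        (trans (cong (2 + N + p +_) (sym e₂))
        (trans (mid N p m S l q) (trans (cong (λ x → 4 + (m + N) + x + (q + l)) (sym e₁)) (rhs N n m a l q)))))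
        where
        lhs : ∀ N p u b → N + (2 + (p + u + b)) + 0 ≡ 2 + N + p + (b + u)
        lhs = solve-∀
        mid : ∀ N p m S l q → 2 + N + p + (m + suc (suc (q + (S + l)))) ≡ 4 + (m + N) + (p + S) + (q + l)
        mid = solve-∀
        rhs : ∀ N n m a l q → 4 + (m + N) + (n + a) + (q + l) ≡ 3 + (suc (n + q) + m) + (N + (a + l))
        rhs = solve-∀
      few : card T ≤ 3 + (suc (n + q) + m)
      few = arith (card T) n m q p u (w M) (w (top k h)) (w (low Δ)) (w S) (w X) eq
        (trans (cong (q +_) (sym (dot-∔ k ones S (low Δ)))) eq″)
        (trans (cong (m +_) (sym (trans (w-bump (bump (suc j) X) i<k) (cong suc (w-bump X j<k))))) eq′) small

    -- With suc c′ = ⌈ hp / r ⌉, the lowest index used by top k hp is k ∸ suc c′ = suc j.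
    module Gap (c′ j : ℕ) (position : c′ + suc j ≡ k′) (hp≤cr : hp ≤ suc c′ * r) (Δ+2≤ : 2 + Δ ≤ suc j * r) where

      J : ℕ
      J = suc j

      J<k : J < k
      J<k = s≤s (≤-trans (m≤n+m J c′) (≤-reflexive position))

      k∸J : k ∸ J ≡ suc c′
      k∸J = trans (cong (λ x → suc x ∸ J) (sym position)) (m+n∸n≡m (suc c′) J)

      k∸sJ : k ∸ suc J ≡ c′
      k∸sJ = trans (cong (_∸ J) (sym position)) (m+n∸n≡m c′ J)

      -- top k hp with one summand moved from index J down to index j.
      S : ℕ → ℕ
      S i = top k h′ i + (1 ⊓ (J ∸ i))

      S-high : ∀ {i} → J ≤ i → S i ≡ top k h′ i
      S-high {i} J≤i = trans (cong (λ x → top k h′ i + (1 ⊓ x)) (m≤n⇒m∸n≡0 J≤i)) (+-identityʳ _)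

      top-flat : ∀ {i} → i ≤ J → top k h′ i ≡ h′
      top-flat {i} i≤J = m≤n⇒m⊓n≡m (≤-trans (<⇒≤ hp≤cr)
        (*-monoˡ-≤ r (≤-trans (≤-reflexive (sym k∸J)) (∸-monoʳ-≤ k i≤J))))

      S-low : ∀ {i} → i < J → S i ≡ hp
      S-low {i} i<J = trans (cong₂ _+_ (top-flat (<⇒≤ i<J)) (m≤n⇒m⊓n≡m (m<n⇒0<n∸m i<J))) (+-comm h′ 1)

      S-J : S J ≡ h′
      S-J = trans (S-high ≤-refl) (top-flat ≤-refl)

      -- Below `J` the state `S` has only one summand, at index `j`, so `Z` may use all places there
      -- but one.
      S∔-valid : ∀ {Z} → Valid J Z → Z j < r → Valid k (S ∔ Z)
      S∔-valid {Z} V Zj<r = valid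
        (λ i → +-mono-≤ (+-mono-≤ (decreasing (top-valid k h′) i) (⊓-monoʳ-≤ 1 (∸-monoʳ-≤ J (n≤1+n i)))) (decreasing V i))
        bnd
        (cong₂ _+_ (trans (S-high (<⇒≤ J<k)) (vanishing (top-valid k h′))) (valid-zero V (<⇒≤ J<k)))
        where
        open ≤-Reasoning
        bnd : ∀ i → S i + Z i ≤ r + (S (suc i) + Z (suc i))
        bnd i with <-cmp i j
        ... | tri< i<j _ _ = begin
          S i + Z i                    ≡⟨ cong (_+ Z i) (trans (S-low (m≤n⇒m≤1+n i<j)) (sym (S-low (s≤s i<j)))) ⟩
          S (suc i) + Z i              ≤⟨ +-monoʳ-≤ (S (suc i)) (bounded V i) ⟩
          S (suc i) + (r + Z (suc i))  ≡⟨ +-left-comm (S (suc i)) r (Z (suc i)) ⟩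
          r + (S (suc i) + Z (suc i))  ∎
        ... | tri≈ _ refl _ = begin
          S j + Z j        ≡⟨ cong (_+ Z j) (S-low ≤-refl) ⟩
          suc (h′ + Z j)   ≡⟨ sym (+-suc h′ (Z j)) ⟩
          h′ + suc (Z j)   ≤⟨ +-monoʳ-≤ h′ Zj<r ⟩
          h′ + r           ≡⟨ +-comm h′ r ⟩
          r + h′           ≡⟨ cong (r +_) (sym S-J) ⟩
          r + S J          ≤⟨ +-monoʳ-≤ r (m≤m+n (S J) (Z J)) ⟩
          r + (S J + Z J)  ∎
        ... | tri> _ _ j<i = begin
          S i + Z i                    ≡⟨ cong₂ _+_ (S-high j<i) (valid-zero V j<i) ⟩
          top k h′ i + 0               ≡⟨ +-identityʳ _ ⟩
          top k h′ i                   ≤⟨ bounded (top-valid k h′) i ⟩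
          r + top k h′ (suc i)         ≡⟨ cong (r +_) (sym (S-high (m≤n⇒m≤1+n j<i))) ⟩
          r + S (suc i)                ≤⟨ +-monoʳ-≤ r (m≤m+n (S (suc i)) (Z (suc i))) ⟩
          r + (S (suc i) + Z (suc i))  ∎

      S-valid : Valid k S
      S-valid = valid-resp (λ i → +-identityʳ (S i)) (S∔-valid {λ _ → 0} (valid (λ _ → z≤n) (λ _ → z≤n) refl) 1≤r)

      S-0 : S 0 ≡ hp
      S-0 = S-low (s≤s z≤n)

      -- Since `M` contains index 0, at most `h′` of its summands have index `J` or more, which is
      -- all that `S` allows there.
      M≤S : M ≤̇ S
      M≤S i with i <? J
      ... | yes i<J = ≤-trans (valid-antitone VM z≤n) (≤-reflexive (trans M0 (sym (S-low i<J))))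
      ... | no  i≮J = ≤-trans (⊓-glb
              (≤-pred (≤-<-trans (valid-antitone VM (≤-trans (s≤s z≤n) (≮⇒≥ i≮J))) M1))
              (≤-trans (≤̇-top VM M0 i) (m⊓n≤n hp ((k ∸ i) * r))))
            (≤-reflexive (sym (S-high (≮⇒≥ i≮J))))

      -- While the value at `J` is still `h′`, the extra summand at `j` can move up: index `J` is
      -- not full because `h′ < suc c′ * r`.
      bump-J-valid : ∀ {R} → Valid k R → S ≤̇ R → R J ≡ h′ → Valid k (bump J R)
      bump-J-valid {R} V S≤R RJ = valid-bump V j J<k
        (begin-strict
          R J  ≡⟨ RJ ⟩
          h′   <⟨ n<1+n h′ ⟩
          hp   ≡⟨ sym (S-low ≤-refl) ⟩
          S j  ≤⟨ S≤R j ⟩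
          R j  ∎)
        (begin-strict
          R J                           ≡⟨ RJ ⟩
          h′                            <⟨ ⊓-glb (+-monoˡ-≤ h′ 1≤r) hp≤cr ⟩
          (r + h′) ⊓ (r + c′ * r)       ≡⟨ sym (+-distribˡ-⊓ r h′ (c′ * r)) ⟩
          r + h′ ⊓ (c′ * r)             ≡⟨ cong (λ x → r + h′ ⊓ (x * r)) (sym k∸sJ) ⟩
          r + top k h′ (suc J)          ≡⟨ cong (r +_) (sym (S-high (n≤1+n J))) ⟩
          r + S (suc J)                 ≤⟨ +-monoʳ-≤ r (S≤R (suc J)) ⟩
          r + R (suc J)                 ∎)
        where open ≤-Reasoning

      low-J : Valid J (low Δ)
      low-J = low-valid J Δ (≤-trans (m≤n+m Δ 2) Δ+2≤)

      low-j<r : low Δ j < r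
      low-j<r = ≤-trans (s≤s (m≤n+o⇒m∸n≤o Δ (j * r) Δ≤)) (≤-reflexive (m+[n∸m]≡n 1≤r))
        where
        Δ≤ : Δ ≤ j * r + (r ∸ 1)
        Δ≤ = +-cancelˡ-≤ 1 _ _ (begin
          1 + Δ                    ≤⟨ n≤1+n (suc Δ) ⟩
          2 + Δ                    ≤⟨ Δ+2≤ ⟩
          r + j * r                ≡⟨ cong (_+ j * r) (sym (m+[n∸m]≡n 1≤r)) ⟩
          1 + (r ∸ 1) + j * r      ≡⟨ cong suc (+-comm (r ∸ 1) (j * r)) ⟩
          1 + (j * r + (r ∸ 1))    ∎)
          where open ≤-Reasoning

      S∔low-valid : Valid k (S ∔ low Δ)
      S∔low-valid = S∔-valid low-J low-j<r

      bump-J-S∔low-valid : Valid k (bump J (S ∔ low Δ))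
      bump-J-S∔low-valid = bump-J-valid {S ∔ low Δ} S∔low-valid (λ i → m≤m+n (S i) (low Δ i)) at-J
        where
        at-J : S J + low Δ J ≡ h′
        at-J = trans (cong₂ _+_ S-J (vanishing low-J)) (+-identityʳ h′)

      gap-jump : g J ≡ σ (low Δ)
      gap-jump = commute-jump {S} {j} S-valid S-0 M≤S J<k
        (bump-J-valid {S} S-valid (λ _ → ≤-refl) S-J) S∔low-valid bump-J-S∔low-valid

      -- After the jump, index 1 can be raised at some state that still has the value `h′` at `J`,
      -- so the raises at 1 and `J` commute there. With `gap-jump` and `g1<σ-low` this refutes
      -- `r < Δ`.
      gap-1 : r < Δ → g J ≡ g 1
      gap-1 r<Δ = result path
        where
        -- The highest placement of Δ summands on the indices below J leaving one place at index j free.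
        high : ℕ → ℕ
        high i = Δ ⊓ ((J ∸ i) * r ∸ 1)

        Δ≤Jr∸1 : Δ ≤ J * r ∸ 1
        Δ≤Jr∸1 = ∸-monoˡ-≤ 1 (≤-trans (n≤1+n (suc Δ)) Δ+2≤)

        high-valid : Valid J high
        high-valid = valid
          (λ i → ⊓-monoʳ-≤ Δ (∸-monoˡ-≤ 1 (*-monoˡ-≤ r (∸-monoʳ-≤ J (n≤1+n i)))))
          (λ i → ⊓-bounded Δ (≤-trans (∸-monoˡ-≤ 1 (∸-suc-*-≤ J i)) (+-∸-≤ r ((J ∸ suc i) * r) 1)))
          (trans (cong (λ x → Δ ⊓ (x * r ∸ 1)) (n∸n≡0 J)) (⊓-zeroʳ Δ))

        high-0 : high 0 ≡ Δ
        high-0 = m≤n⇒m⊓n≡m Δ≤Jr∸1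

        high-j<r : high j < r
        high-j<r = ≤-trans (s≤s (≤-trans (m⊓n≤n Δ _) (≤-reflexive (cong (_∸ 1) (trans (cong (_* r) (m+n∸n≡m 1 j)) (+-identityʳ r))))))
          (≤-reflexive (m+[n∸m]≡n 1≤r))

        -- The 2 in `Δ+2≤` is spent here: one for the free place at index `j`, one for the raise at
        -- index 1.
        low-1<high-1 : low Δ 1 < high 1
        low-1<high-1 = ⊓-glb
          (≤-trans (s≤s (∸-monoʳ-≤ Δ (≤-trans 1≤r (m≤m+n r 0)))) (≤-reflexive (m+[n∸m]≡n 1≤Δ)))
          (∸-monoˡ-≤ 1 (begin
            2 + (Δ ∸ 1 * r)    ≡⟨ cong (λ x → 2 + (Δ ∸ x)) (+-identityʳ r) ⟩
            2 + (Δ ∸ r)        ≡⟨ sym (+-∸-assoc 2 (<⇒≤ r<Δ)) ⟩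
            2 + Δ ∸ r          ≤⟨ ∸-monoˡ-≤ r Δ+2≤ ⟩
            r + j * r ∸ r      ≡⟨ m+n∸m≡n r (j * r) ⟩
            j * r              ∎))
          where open ≤-Reasoning

        Path : (ℕ → ℕ) → Set
        Path R = Valid k R × S ∔ low Δ ≤̇ R × Valid k (bump 1 R) × bump 1 R ≤̇ S ∔ high

        path : ∃[ R ] Path R
        path = passes-through {k} {S ∔ low Δ} {S ∔ high} S∔low-valid (S∔-valid {high} high-valid high-j<r)
          (λ i → +-monoʳ-≤ (S i) (low-≤̇ {J} {high} high-valid high-0 i)) (cong (S 0 +_) (sym high-0))
          1 (+-monoʳ-< (S 1) low-1<high-1)

        result : ∃[ R ] Path R → g J ≡ g 1
        result (R , VR , P≤R , VR′ , R′≤Q) =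
          commute-moves {S} {R} {j} {0} S-valid S-0 M≤S S∔low-valid P≤R
            (≤-antisym (≤-trans (R′≤Q 0) (≤-reflexive (cong₂ _+_ S-0 high-0)))
                       (≤-trans (≤-reflexive (cong (_+ Δ) (sym S-0))) (P≤R 0)))
            J<k (≤-trans (s≤s (s≤s z≤n)) J<k) VR
            (bump-J-valid {R} VR S≤R (≤-antisym (≤-trans (≤̇-bump 1 R J) upper) lower))
            VR′
            (bump-J-valid {bump 1 R} VR′ (λ i → ≤-trans (S≤R i) (≤̇-bump 1 R i)) (≤-antisym upper (≤-trans lower (≤̇-bump 1 R J))))
          where
          S≤R : S ≤̇ R
          S≤R i = ≤-trans (m≤m+n (S i) (low Δ i)) (P≤R i)
          upper : bump 1 R J ≤ h′
          upper = ≤-trans (R′≤Q J) (≤-reflexive (trans (cong₂ _+_ S-J (vanishing high-valid)) (+-identityʳ h′)))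
          lower : h′ ≤ R J
          lower = ≤-trans (≤-reflexive (sym S-J)) (S≤R J)

    -- Divide `h′` by `r` and subtract `c′ * r ≤ h′` from `hp + Δ < k′ * r`. The 2 comes from
    -- `hp = suc h′` and from the strict inequality.
    locate : ∃[ c′ ] ∃[ j ] (c′ + suc j ≡ k′ × hp ≤ suc c′ * r × 2 + Δ ≤ suc j * r)
    locate = q , j , position , h′<r+qr , +-cancelˡ-≤ h′ _ _ (begin
      h′ + (2 + Δ)          ≡⟨ shift h′ Δ ⟩
      suc (hp + Δ)          ≤⟨ h<k′r ⟩
      k′ * r                ≡⟨ cong (_* r) (sym position) ⟩
      (q + suc j) * r       ≡⟨ *-distribʳ-+ r q (suc j) ⟩
      q * r + suc j * r     ≤⟨ +-monoˡ-≤ (suc j * r) qr≤h′ ⟩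
      h′ + suc j * r        ∎)
      where
      open ≤-Reasoning
      instance
        r≢0 : NonZero r
        r≢0 = >-nonZero 1≤r
      q : ℕ
      q = h′ / r
      h′≡ : h′ ≡ h′ % r + q * r
      h′≡ = m≡m%n+[m/n]*n h′ r
      h′<r+qr : h′ < r + q * r
      h′<r+qr = ≤-trans (s≤s (≤-reflexive h′≡)) (+-monoˡ-≤ (q * r) (m%n<n h′ r))
      qr≤h′ : q * r ≤ h′
      qr≤h′ = ≤-trans (m≤n+m (q * r) (h′ % r)) (≤-reflexive (sym h′≡))
      q<k′ : q < k′
      q<k′ = *-cancelʳ-< r q k′ (≤-<-trans (≤-trans qr≤h′ (≤-trans (n≤1+n h′) (m≤m+n hp Δ))) h<k′r)
      j : ℕ
      j = k′ ∸ suc q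
      position : q + suc j ≡ k′
      position = trans (+-suc q j) (m+[n∸m]≡n q<k′)
      shift : ∀ h d → h + (2 + d) ≡ suc (suc h + d)
      shift = solve-∀

    low-suc≡0 : Δ ≤ r → ∀ j → low Δ (suc j) ≡ 0
    low-suc≡0 Δ≤r j = m≤n⇒m∸n≡0 (≤-trans Δ≤r (m≤m+n r (j * r)))

    σ-low : Δ ≤ r → σ (low Δ) ≡ g 0 * Δ
    σ-low Δ≤r = trans (cong (g 0 * Δ +_) (dot-zero k′ (g ∘ suc) (low-suc≡0 Δ≤r))) (+-identityʳ _)

    g1<σ-low : 0 < k′ → r < Δ → g 1 < σ (low Δ)
    g1<σ-low 0<k′ r<Δ = +-mono-≤ σ-head (≤-trans tail (dot-≥ k′ (g ∘ suc) (low Δ ∘ suc) 0<k′))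
      where
      σ-head : 1 ≤ g 0 * Δ
      σ-head = *-mono-≤ (g-pos (s≤s z≤n)) 1≤Δ
      tail : g 1 ≤ g 1 * low Δ 1
      tail = ≤-trans (≤-reflexive (sym (*-identityʳ (g 1))))
        (*-monoʳ-≤ (g 1) (m<n⇒0<n∸m (≤-<-trans (≤-reflexive (+-identityʳ r)) r<Δ)))

    jump-size : Δ ≤ r × ∃[ j ] (suc j < k × g (suc j) ≡ g 0 * Δ)
    jump-size = from locate
      where
      from : ∃[ c′ ] ∃[ j ] (c′ + suc j ≡ k′ × hp ≤ suc c′ * r × 2 + Δ ≤ suc j * r) →
             Δ ≤ r × ∃[ j ] (suc j < k × g (suc j) ≡ g 0 * Δ)
      from (c′ , j , position , hp≤ , Δ+2≤) = Δ≤r , j , G.J<k , trans G.gap-jump (σ-low Δ≤r)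
        where
        module G = Gap c′ j position hp≤ Δ+2≤
        Δ≤r : Δ ≤ r
        Δ≤r with Δ ≤? r
        ... | yes p = p
        ... | no ¬p = contradiction (trans (sym (G.gap-1 (≰⇒> ¬p))) G.gap-jump)
                        (<⇒≢ (g1<σ-low (≤-trans (s≤s z≤n) (≤-pred G.J<k)) (≰⇒> ¬p)))

    -- Here `M` lies below every state for `hp`, so the jump may start anywhere. This freedom
    -- determines all gaps instead of one.
    module First (M≤low : M ≤̇ low hp) (Δ≤r : Δ ≤ r) (3≤k′ : 3 ≤ k′) where

      M≤ : ∀ {R} → Valid k R → R 0 ≡ hp → M ≤̇ R
      M≤ V R0 i = ≤-trans (M≤low i) (low-≤̇ V R0 i)

      -- The lowest state avoiding index 0 and, when c = 1, one copy of index 1.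
      base : ℕ → ℕ → ℕ
      base c j = hp ∸ ((j ∸ 1) * r ∸ c)

      hp+1<k′r : hp + 1 < k′ * r
      hp+1<k′r = ≤-<-trans (+-monoʳ-≤ hp 1≤Δ) h<k′r

      base-valid : ∀ c → c ≤ 1 → Valid k (base c)
      base-valid c c≤1 = valid
        (λ j → ∸-monoʳ-≤ hp (∸-monoˡ-≤ c (*-monoˡ-≤ r (∸-monoˡ-≤ 1 (n≤1+n j)))))
        (λ j → m≤n+o⇒m∸n≤o hp ((j ∸ 1) * r ∸ c) (begin
          hp                                                    ≤⟨ m≤n+m∸n hp (j * r ∸ c) ⟩
          j * r ∸ c + base c (suc j)                           ≤⟨ +-monoˡ-≤ _ (increment j) ⟩
          r + ((j ∸ 1) * r ∸ c) + base c (suc j)               ≡⟨ swap r ((j ∸ 1) * r ∸ c) (base c (suc j)) ⟩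
          (j ∸ 1) * r ∸ c + (r + base c (suc j))               ∎))
        (m≤n⇒m∸n≡0 (m+n≤o⇒m≤o∸n hp (≤-trans (+-monoʳ-≤ hp c≤1) (<⇒≤ hp+1<k′r))))
        where
        open ≤-Reasoning
        swap : ∀ r x y → r + x + y ≡ x + (r + y)
        swap = solve-∀
        increment : ∀ j → j * r ∸ c ≤ r + ((j ∸ 1) * r ∸ c)
        increment zero    = ≤-trans (m∸n≤m 0 c) z≤n
        increment (suc j) = +-∸-≤ r (j * r) c

      base<top : ∀ c → c ≤ 1 → ∀ j → j < k′ → c < j * r → base c (suc j) < top k hp (suc j)
      base<top c c≤1 j j<k′ c<jr = ⊓-glb
        (s≤s (∸-monoʳ-≤ hp (m<n⇒0<n∸m c<jr)))
        (m<n+o⇒m∸n<o hp (j * r ∸ c) (+-cancelʳ-< c _ _ (begin-strict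
          hp + c                               ≤⟨ +-monoʳ-≤ hp c≤1 ⟩
          hp + 1                               <⟨ hp+1<k′r ⟩
          k′ * r                               ≡⟨ cong (_* r) (sym (m+[n∸m]≡n (<⇒≤ j<k′))) ⟩
          (j + (k′ ∸ j)) * r                   ≡⟨ *-distribʳ-+ r j (k′ ∸ j) ⟩
          j * r + (k′ ∸ j) * r                 ≡⟨ cong (_+ (k′ ∸ j) * r) (sym (m∸n+n≡m (<⇒≤ c<jr))) ⟩
          j * r ∸ c + c + (k′ ∸ j) * r         ≡⟨ swap (j * r ∸ c) c ((k′ ∸ j) * r) ⟩
          j * r ∸ c + (k′ ∸ j) * r + c         ∎)))
        where
        open ≤-Reasoning
        instance
          room : NonZero ((k′ ∸ j) * r)
          room = >-nonZero (*-mono-≤ (m<n⇒0<n∸m j<k′) 1≤r)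
        swap : ∀ x y z → x + y + z ≡ x + z + y
        swap = solve-∀

      Path : ℕ → ℕ → (ℕ → ℕ) → Set
      Path c j R = Valid k R × base c ≤̇ R × Valid k (bump j R) × bump j R ≤̇ top k hp

      hp≤kr : hp ≤ k * r
      hp≤kr = ≤-trans (m≤m+n hp Δ) h≤kr

      base-0 : ∀ c → base c 0 ≡ hp
      base-0 c = cong (hp ∸_) (0∸n≡0 c)

      path : ∀ c → c ≤ 1 → ∀ j → j < k′ → c < j * r → ∃[ R ] Path c (suc j) R
      path c c≤1 j j<k′ c<jr = passes-through {k} {base c} {top k hp} (base-valid c c≤1) (top-valid k hp)
        (≤̇-top (base-valid c c≤1) (base-0 c)) (trans (base-0 c) (sym (top-0 k hp hp≤kr)))
        (suc j) (base<top c c≤1 j j<k′ c<jr)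

      -- A state without index 0 leaves room for the jump, which adds Δ ≤ r copies of it.
      ∔low-valid : ∀ {R} → Valid k R → R 0 ≤ R 1 → Valid k (R ∔ low Δ)
      ∔low-valid {R} V R0≤R1 = valid-∔ V (low-valid k Δ (≤-trans (m≤n+m Δ hp) h≤kr)) alt
        where
        alt : ∀ j → R j ≤ R (suc j) ⊎ low Δ j ≤ low Δ (suc j)
        alt zero    = inj₁ R0≤R1
        alt (suc j) = inj₂ (≤-trans (≤-reflexive (low-suc≡0 Δ≤r j)) z≤n)

      -- From `base c` up to the top, the values at 0 and 1 are pinned to `hp`, so index 0 does not
      -- occur; the jump is possible both before and after the raise at `j`.
      module Along {c j R} (2≤j : 2 ≤ j) (walk : Path c j R) where

        VR : Valid k R
        VR = let V , _ = walk in V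

        base≤R : base c ≤̇ R
        base≤R = let _ , le , _ = walk in le

        VB : Valid k (bump j R)
        VB = let _ , _ , V , _ = walk in V

        R≤top : R ≤̇ top k hp
        R≤top i = let _ , _ , _ , le = walk in ≤-trans (≤̇-bump j R i) (le i)

        R≡hp : ∀ {i} → base c i ≡ hp → R i ≡ hp
        R≡hp {i} eq = ≤-antisym (≤-trans (R≤top i) (m⊓n≤m hp _)) (≤-trans (≤-reflexive (sym eq)) (base≤R i))

        R0 : R 0 ≡ hp
        R0 = R≡hp (base-0 c)

        R1 : R 1 ≡ hp
        R1 = R≡hp (base-0 c)

        VX : Valid k (R ∔ low Δ)
        VX = ∔low-valid VR (≤-reflexive (trans R0 (sym R1)))

        VBX : Valid k (bump j (R ∔ low Δ))
        VBX = valid-resp (bump-∔ j R (low Δ)) (∔low-valid VB (≤-reflexive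
          (trans (bump-≢ j R (λ j≡0 → <⇒≢ (≤-trans (s≤s z≤n) 2≤j) (sym j≡0)))
          (trans (trans R0 (sym R1)) (sym (bump-≢ j R (λ j≡1 → <⇒≢ 2≤j (sym j≡1))))))))

      gap-≥2 : ∀ j → suc (suc j) < k → g (suc (suc j)) ≡ g 0 * Δ
      gap-≥2 j j<k = from (path 0 z≤n (suc j) (≤-pred j<k) (≤-trans 1≤r (m≤m+n r (j * r))))
        where
        from : ∃[ R ] Path 0 (suc (suc j)) R → g (suc (suc j)) ≡ g 0 * Δ
        from (R , walk) = trans (commute-jump {R} {suc j} W.VR W.R0 (M≤ W.VR W.R0) j<k W.VB W.VX W.VBX) (σ-low Δ≤r)
          where module W = Along {0} {suc (suc j)} {R} (s≤s (s≤s z≤n)) walk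

      -- The jump supplies the copies of index 0 that a raise at 1 needs, and `c = 1` leaves a free
      -- place at index 1. The partner is 3 because for `r = 1` the value of `base 1` at 2 is
      -- already `hp`; moreover, raising 3 does not touch the values at 0, 1 and 2 that govern a
      -- raise at 1.
      gap-1≡gap-3 : g 1 ≡ g 3
      gap-1≡gap-3 = from (path 1 ≤-refl 2 3≤k′ (+-mono-≤ 1≤r (≤-trans 1≤r (m≤m+n r 0))))
        where
        from : ∃[ R ] Path 1 3 R → g 1 ≡ g 3
        from (R , walk) = commute-moves {R} {X} {0} {2} W.VR W.R0 (M≤ W.VR W.R0) W.VX (λ _ → ≤-refl)
            (cong (_+ Δ) W.R0) 1<k (s≤s 3≤k′) W.VX (bump-1 {X} W.VX refl refl refl) W.VBX (bump-1 {bump 3 X} W.VBX refl refl refl)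
          where
          module W = Along {1} {3} {R} (s≤s (s≤s z≤n)) walk
          X : ℕ → ℕ
          X = R ∔ low Δ
          1<k : 1 < k
          1<k = s≤s (≤-trans (s≤s z≤n) 3≤k′)
          X1 : X 1 ≡ hp
          X1 = trans (cong₂ _+_ W.R1 (low-suc≡0 Δ≤r 0)) (+-identityʳ hp)
          1<0 : X 1 < X 0
          1<0 = subst₂ _<_ (sym X1) (cong (_+ Δ) (sym W.R0)) (m<m+n hp 1≤Δ)
          1<2 : X 1 < r + X 2
          1<2 = begin-strict
            X 1                       ≡⟨ X1 ⟩
            hp                        ≤⟨ m≤n+m∸n hp (1 * r ∸ 1) ⟩
            1 * r ∸ 1 + base 1 2     <⟨ +-mono-<-≤ (≤-trans (s≤s (≤-reflexive (cong (_∸ 1) (+-identityʳ r)))) (≤-reflexive (m+[n∸m]≡n 1≤r)))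
                                           (≤-trans (W.base≤R 2) (m≤m+n (R 2) (low Δ 2))) ⟩
            r + X 2                   ∎
            where open ≤-Reasoning
          bump-1 : ∀ {Y} → Valid k Y → Y 0 ≡ X 0 → Y 1 ≡ X 1 → Y 2 ≡ X 2 → Valid k (bump 1 Y)
          bump-1 V e₀ e₁ e₂ = valid-bump V 0 1<k (subst₂ _<_ (sym e₁) (sym e₀) 1<0)
            (subst₂ (λ a b → a < r + b) (sym e₁) (sym e₂) 1<2)

      gaps : ∀ j → suc j < k → g (suc j) ≡ g 0 * Δ
      gaps zero    _   = trans gap-1≡gap-3 (gap-≥2 1 (s≤s 3≤k′))
      gaps (suc j) j<k = gap-≥2 j j<k

  -- The chain through all of H, one jump after another.

  Admissible : ℕ → Set
  Admissible h = h ∈ H × h < k′ * r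

  top∈T : ∀ {h} → Admissible h → σ (top k h) ∈ T
  top∈T {h} (h∈H , h<) = sum∈T (top-valid k h) (subst (_∈ H) (sym (top-0 k h (≤-trans (<⇒≤ h<) (m≤n+m (k′ * r) r)))) h∈H)

  top∔low-0 : ∀ hp Δ → hp + Δ < k′ * r → (top k hp ∔ low Δ) 0 ≡ hp + Δ
  top∔low-0 hp Δ h< = cong (_+ Δ) (top-0 k hp (≤-trans (m≤m+n hp Δ) (≤-trans (<⇒≤ h<) (m≤n+m (k′ * r) r))))

  ascend-jump : ∀ hp Δ → Admissible (hp + Δ) → Chain T (rise k hp (hp + Δ)) (σ (top k hp ∔ low Δ)) (σ (top k (hp + Δ)))
  ascend-jump hp Δ (h∈H , h<)
    with n , c , eq ← ascend h∈H (top∔low-valid k′ hp Δ (<⇒≤ h<)) (top-valid k (hp + Δ)) (top∔low-0 hp Δ h<)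
           (top-0 k (hp + Δ) (≤-trans (<⇒≤ h<) (m≤n+m (k′ * r) r)))
           (≤̇-top (top∔low-valid k′ hp Δ (<⇒≤ h<)) (top∔low-0 hp Δ h<))
    = subst (λ x → Chain T x (σ (top k hp ∔ low Δ)) (σ (top k (hp + Δ))))
        (+-cancelʳ-≡ (w (top k hp ∔ low Δ)) n (rise k hp (hp + Δ)) (trans eq (sym
          (trans (cong (rise k hp (hp + Δ) +_) (dot-∔ k ones (top k hp) (low Δ))) (rise-+ k′ hp Δ (<⇒≤ h<))))))
        c

  ascent : ∀ hp hs → Linked _<_ (hp ∷ hs) → All Admissible (hp ∷ hs) → ∃[ z ] Chain T (climbs k′ hp hs) (σ (top k hp)) z
  ascent hp []       _               (ok ∷ [])       = σ (top k hp) , [ top∈T ok ]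
  ascent hp (h ∷ hs) (hp<h ∷ sorted) (ok ∷ ok′ ∷ oks) =
    go (h ∸ hp) (m+[n∸m]≡n (<⇒≤ hp<h)) hp<h ok′ (ascent h hs sorted (ok′ ∷ oks))
    where
    -- Generalising `h` lets the match on `refl` replace it by `hp + Δ`.
    go : ∀ Δ {h} → hp + Δ ≡ h → hp < h → Admissible h → ∃[ z ] Chain T (climbs k′ h hs) (σ (top k h)) z →
         ∃[ z ] Chain T (suc (rise k hp h) + climbs k′ h hs) (σ (top k hp)) z
    go Δ refl hp<h ok′ (z , c) = z , chain (top∈T ok) (σ-<-jump (top k hp) (+-cancelˡ-< hp 0 Δ (≤-<-trans (≤-reflexive (+-identityʳ hp)) hp<h)))
      (chain-join (ascend-jump hp Δ ok′) c)

  -- Invariant before the jump away from `hp`: the chain entered this level at `base` after `p`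
  -- steps, and by `count` its continuation through the tops exhausts `T`.
  record Position (hp : ℕ) (hs : List ℕ) : Set where
    field
      {base}   : ℕ → ℕ
      {p s}    : ℕ
      base-ok  : Valid k base
      base-0   : base 0 ≡ hp
      base-1   : base 1 < hp
      prefix   : Chain T p s (σ base)
      count    : card T + w base ≤ suc p + w (top k hp) + climbs k′ hp hs

  module Next (h′ Δ : ℕ) (hs : List ℕ) (pos : Position (suc h′) (suc h′ + Δ ∷ hs)) (1≤Δ : 1 ≤ Δ)
    (sorted : Linked _<_ (suc h′ + Δ ∷ hs)) (ok : Admissible (suc h′)) (oks : All Admissible (suc h′ + Δ ∷ hs)) where
    open Position pos

    private
      hp h : ℕ
      hp = suc h′
      h  = hp + Δ

      ok-h : Admissible h
      ok-h = All.head oks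

      rest : ∃[ z ] Chain T (climbs k′ h hs) (σ (top k h)) z
      rest = ascent h hs sorted oks

      rise-eq : rise k hp h + (w (top k hp) + w (low Δ)) ≡ w (top k h)
      rise-eq = rise-+ k′ hp Δ (<⇒≤ (proj₂ ok-h))

      small : card T + (w base + w (low Δ)) ≤ 2 + (p + climbs k′ h hs + w (top k h))
      small = arith (card T) (w base) (w (low Δ)) p (w (top k hp)) (rise k hp h) (climbs k′ h hs) (w (top k h)) rise-eq count
        where
        arith : ∀ N b l p t i c x → i + (t + l) ≡ x → N + b ≤ suc p + t + (suc i + c) → N + (b + l) ≤ 2 + (p + c + x)
        arith N b l p t i c x refl le = ≤-certificate 0 le (tidy N b l p t i c)
          where
          tidy : ∀ N b l p t i c → N + (b + l) + (suc p + t + (suc i + c)) + 0 ≡ 2 + (p + c + (i + (t + l))) + (N + b)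
          tidy = solve-∀

    open Jump h′ Δ (proj₁ ok) (proj₁ ok-h) 1≤Δ (proj₂ ok-h) base base-ok base-0 base-1 prefix (proj₂ rest) small public

    next : Position h hs
    next with n , c , eq ← reach (top-valid k hp) (top-0 k hp (≤-trans (m≤m+n hp Δ) h≤kr)) (≤̇-top base-ok base-0) = record
      { base    = top k hp ∔ low Δ
      ; base-ok = top∔low-valid k′ hp Δ (<⇒≤ (proj₂ ok-h))
      ; base-0  = top∔low-0 hp Δ (proj₂ ok-h)
      -- The jump has just put at least one summand on index 0.
      ; base-1  = +-mono-≤-< (m⊓n≤m hp _) (≤-trans (s≤s (∸-monoʳ-≤ Δ (≤-trans 1≤r (m≤m+n r 0)))) (≤-reflexive (m+[n∸m]≡n 1≤Δ)))
      ; prefix  = chain-++ c (σ-<-jump (top k hp) 1≤Δ)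
                    [ sum∈T (top∔low-valid k′ hp Δ (<⇒≤ (proj₂ ok-h))) (subst (_∈ H) (sym (top∔low-0 hp Δ (proj₂ ok-h))) (proj₁ ok-h)) ]
      ; count   = arith (card T) (w base) (w (low Δ)) p n (w (top k hp)) (rise k hp h) (climbs k′ h hs) (w (top k h)) (w (top k hp ∔ low Δ))
                    (dot-∔ k ones (top k hp) (low Δ)) rise-eq eq count
      }
      where
      arith : ∀ N b l p n t i c x m → m ≡ t + l → i + (t + l) ≡ x → n + b ≡ p + t → N + b ≤ suc p + t + (suc i + c) →
              N + m ≤ suc (suc (n + 0)) + x + c
      arith N b l p n t i c x m refl refl eq le = ≤-certificate 0 le (trans (expand N t l p i c)
        (trans (cong (λ y → y + (N + t + l + 2 + i + c)) (sym eq)) (tidy N b l n t i c)))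
        where
        expand : ∀ N t l p i c → N + (t + l) + (suc p + t + (suc i + c)) + 0 ≡ (p + t) + (N + t + l + 2 + i + c)
        expand = solve-∀
        tidy : ∀ N b l n t i c → (n + b) + (N + t + l + 2 + i + c) ≡ suc (suc (n + 0)) + (i + (t + l)) + c + (N + b)
        tidy = solve-∀

  -- Each jump Δ makes some gap equal to `g 0 * Δ`; as all gaps are `g 0 * d`, cancelling `g 0`
  -- gives `Δ ≡ d`.
  walk : ∀ d → (∀ j → suc j < k → g (suc j) ≡ g 0 * d) → ∀ hp hs → 1 ≤ hp → Position hp hs →
         Linked _<_ (hp ∷ hs) → All Admissible (hp ∷ hs) → Linked (λ x y → y ≡ x + d) (hp ∷ hs)
  walk d gaps hp       []       _ pos sorted          _                = [-]
  walk d gaps (suc h′) (h ∷ hs) _ pos (hp<h ∷ sorted) (ok ∷ oks) =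
    go (h ∸ suc h′) (m+[n∸m]≡n (<⇒≤ hp<h)) hp<h pos sorted oks
    where
    go : ∀ Δ {h} → suc h′ + Δ ≡ h → suc h′ < h → Position (suc h′) (h ∷ hs) → Linked _<_ (h ∷ hs) → All Admissible (h ∷ hs) →
         Linked (λ x y → y ≡ x + d) (suc h′ ∷ h ∷ hs)
    go Δ refl hp<h pos sorted oks = cong (suc h′ +_) (size N.jump-size) ∷ walk d gaps (suc h′ + Δ) hs (s≤s z≤n) N.next sorted oks
      where
      module N = Next h′ Δ hs pos (+-cancelˡ-< (suc h′) 0 Δ (≤-<-trans (≤-reflexive (+-identityʳ (suc h′))) hp<h)) sorted ok oks
      size : Δ ≤ r × ∃[ j ] (suc j < k × g (suc j) ≡ g 0 * Δ) → Δ ≡ d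
      size (_ , j , j<k , eq) = *-cancelˡ-≡ Δ d (g 0) {{>-nonZero (g-pos (s≤s z≤n))}} (trans (sym eq) (gaps j j<k))

  structure : 3 ≤ k′ → ∀ h₁ h₂ hs → 1 ≤ h₁ → Linked _<_ (h₁ ∷ h₂ ∷ hs) → All Admissible (h₁ ∷ h₂ ∷ hs) →
    card T ≤ climbs k′ 0 (h₁ ∷ h₂ ∷ hs) →
    ∃[ d ] (d ≤ r × Linked (λ x y → y ≡ x + d) (h₁ ∷ h₂ ∷ hs) × (∀ j → suc j < k → g (suc j) ≡ g 0 * d))
  structure 3≤k′ (suc h′) h₂ hs _ (h₁<h₂ ∷ sorted) (ok ∷ oks) few =
    go (h₂ ∸ suc h′) (m+[n∸m]≡n (<⇒≤ h₁<h₂)) h₁<h₂ few sorted oks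
    where
    h₁ : ℕ
    h₁ = suc h′
    low-≤ : low h₁ ≤̇ low h₁
    low-≤ _ = ≤-refl
    h₁≤kr : h₁ ≤ k * r
    h₁≤kr = ≤-trans (<⇒≤ (proj₂ ok)) (m≤n+m (k′ * r) r)
    low-ok : Valid k (low h₁)
    low-ok = low-valid k h₁ h₁≤kr
    -- A jump from 0: `top k 0` has weight 0, and the landing state is `low h₁`.
    first-rise : rise k 0 h₁ + w (low h₁) ≡ w (top k h₁)
    first-rise = trans (cong (λ x → rise k 0 h₁ + (x + w (low h₁))) (sym (dot-zero k ones (λ _ → refl))))
                   (rise-+ k′ 0 h₁ (<⇒≤ (proj₂ ok)))
    pos : ∀ h₂ → card T ≤ climbs k′ 0 (h₁ ∷ h₂ ∷ hs) → Position h₁ (h₂ ∷ hs)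
    pos h₂ few = record
      { base = low h₁ ; base-ok = low-ok ; base-0 = refl
      ; base-1 = s≤s (∸-monoʳ-≤ h₁ (≤-trans 1≤r (m≤m+n r 0)))
      ; prefix = [ sum∈T low-ok (proj₁ ok) ]
      ; count = arith (card T) (rise k 0 h₁) (w (low h₁)) (w (top k h₁)) (climbs k′ h₁ (h₂ ∷ hs)) first-rise few
      }
      where
      arith : ∀ N i l t c → i + l ≡ t → N ≤ suc i + c → N + l ≤ 1 + t + c
      arith N i l t c refl le = ≤-certificate 0 le (tidy N i l c)
        where
        tidy : ∀ N i l c → N + l + (suc i + c) + 0 ≡ 1 + (i + l) + c + N
        tidy = solve-∀
    go : ∀ Δ {h₂} → suc h′ + Δ ≡ h₂ → suc h′ < h₂ → card T ≤ climbs k′ 0 (h₁ ∷ h₂ ∷ hs) → Linked _<_ (h₂ ∷ hs) → All Admissible (h₂ ∷ hs) →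
         ∃[ d ] (d ≤ r × Linked (λ x y → y ≡ x + d) (h₁ ∷ h₂ ∷ hs) × (∀ j → suc j < k → g (suc j) ≡ g 0 * d))
    go Δ refl lt few sorted oks = Δ , proj₁ N.jump-size , walk Δ F.gaps h₁ (h₁ + Δ ∷ hs) (s≤s z≤n) (pos (h₁ + Δ) few) (lt ∷ sorted) (ok ∷ oks) , F.gaps
      where
      module N = Next h′ Δ hs (pos (h₁ + Δ) few) (+-cancelˡ-< h₁ 0 Δ (≤-<-trans (≤-reflexive (+-identityʳ h₁)) lt)) sorted ok oks
      module F = N.First low-≤ (proj₁ N.jump-size) 3≤k′

-- Increasing lists: gaps, arithmetic progressions, extremes.

gap : ℕ → List ℕ → ℕ → ℕ
gap p []       j       = 0
gap p (a ∷ as) zero    = a ∸ p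
gap p (a ∷ as) (suc j) = gap a as j

gap-pos : ∀ {p as} → Linked _<_ (p ∷ as) → ∀ {j} → j < length as → 1 ≤ gap p as j
gap-pos {as = a ∷ as} (p<a ∷ _)      {zero}  _         = m<n⇒0<n∸m p<a
gap-pos {as = a ∷ as} (_ ∷ sorted) {suc j} (s≤s j<n) = gap-pos sorted j<n

equal-gaps : ∀ {p as D} → Linked _<_ (p ∷ as) → (∀ j → j < length as → gap p as j ≡ D) → Linked (λ x y → y ≡ x + D) (p ∷ as)
equal-gaps {as = []}     _              _    = [-]
equal-gaps {p} {a ∷ as} (p<a ∷ sorted) gaps =
  trans (sym (m+[n∸m]≡n (<⇒≤ p<a))) (cong (λ x → p + x) (gaps 0 (s≤s z≤n))) ∷ equal-gaps sorted (λ j j<n → gaps (suc j) (s≤s j<n))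

constant-step⇒IsAP : ∀ {d x xs} → Linked (λ x y → y ≡ x + d) (x ∷ xs) → IsAP d (x ∷ xs)
constant-step⇒IsAP {d} {x} {xs} steps = x , suc (length xs) , λ y → mk⇔ (to steps) (λ (i , i<n , eq) → subst (_∈ x ∷ xs) (sym eq) (from steps i i<n))
  where
  to : ∀ {x xs y} → Linked (λ x y → y ≡ x + d) (x ∷ xs) → y ∈ x ∷ xs → ∃[ i ] (i < suc (length xs) × y ≡ x + i * d)
  to _ (here refl) = 0 , s≤s z≤n , sym (+-identityʳ _)
  to {x} (refl ∷ steps) (there y∈) with i , i<n , eq ← to steps y∈ = suc i , s≤s i<n , trans eq (+-assoc x d (i * d))
  from : ∀ {x xs} → Linked (λ x y → y ≡ x + d) (x ∷ xs) → ∀ i → i < suc (length xs) → x + i * d ∈ x ∷ xs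
  from _              zero    _         = here (+-identityʳ _)
  from [-]            (suc i) (s≤s ())
  from {x} {y ∷ ys} (refl ∷ steps) (suc i) (s≤s i<n) = there (subst (_∈ y ∷ ys) (+-assoc x d (i * d)) (from steps i i<n))

listMin-sorted : ∀ {a as} → Linked _<_ (a ∷ as) → listMin (a ∷ as) ≡ a
listMin-sorted {a} sorted = go (All.tail (Linked⇒All ≤-trans ≤-refl (Linked.map <⇒≤ sorted)))
  where
  go : ∀ {xs} → All (a ≤_) xs → foldr _⊓_ a xs ≡ a
  go []                  = refl
  go {x ∷ _} (a≤x ∷ all) = trans (cong (x ⊓_) (go all)) (m≥n⇒m⊓n≡n a≤x)

≤-listMax : ∀ xs → All (_≤ listMax xs) xs
≤-listMax []       = []
≤-listMax (x ∷ xs) = m≤m⊔n x (listMax xs) ∷ All.map (λ y≤ → ≤-trans y≤ (m≤n⊔m x (listMax xs))) (≤-listMax xs)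

-- Sums of states are restricted sums.

module Sums (r : ℕ) (1≤r : 1 ≤ r) where
  open States r 1≤r

  -- The earlier clauses of `sumsList` match on `h`, so this one reduces only after a case split.
  sumsList-∷ : ∀ h a as → sumsList r h (a ∷ as) ≡ concatMap (λ l → map (λ s → l * a + s) (sumsList r (h ∸ l) as)) (upTo (suc (r ⊓ h)))
  sumsList-∷ zero    a as = refl
  sumsList-∷ (suc h) a as = refl

  -- Abel summation: P j - P (j + 1) is the multiplicity of the j-th summand.
  state∈sumsList : ∀ p as {P} → Linked _<_ (p ∷ as) → Valid (length as) P → p * P 0 + dot (length as) (gap p as) P ∈ sumsList r (P 0) as
  state∈sumsList p [] {P} _ V = subst (λ x → p * x + 0 ∈ sumsList r x []) (sym (vanishing V)) (here (trans (+-identityʳ (p * 0)) (*-zeroʳ p)))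
  state∈sumsList p (a ∷ as) {P} (p<a ∷ sorted) V = subst₂ _∈_ value (sym (sumsList-∷ (P 0) a as))
    (∈-concatMap⁺ (λ l → map (λ s → l * a + s) (sumsList r (P 0 ∸ l) as)) (lose (∈-upTo⁺ (s≤s (⊓-glb l≤r (m∸n≤m (P 0) (P 1)))))
      (∈-map⁺ (λ s → l * a + s) (subst (λ x → a * P 1 + rest ∈ sumsList r x as) (sym (m∸[m∸n]≡n (decreasing V 0)))
        (state∈sumsList a as {P ∘ suc} sorted tail)))))
    where
    tail : Valid (length as) (P ∘ suc)
    tail = valid (decreasing V ∘ suc) (bounded V ∘ suc) (vanishing V)
    rest l t : ℕ
    rest = dot (length as) (gap a as) (P ∘ suc)
    l = P 0 ∸ P 1
    t = a ∸ p
    l≤r : l ≤ r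
    l≤r = m≤n+o⇒m∸n≤o (P 0) (P 1) (≤-trans (bounded V 0) (≤-reflexive (+-comm r (P 1))))
    rearrange : ∀ l p t q x → l * (p + t) + ((p + t) * q + x) ≡ p * (l + q) + (t * (l + q) + x)
    rearrange = solve-∀
    value : l * a + (a * P 1 + rest) ≡ p * P 0 + (t * P 0 + rest)
    value = subst₂ (λ x y → l * x + (x * P 1 + rest) ≡ p * y + (t * y + rest))
      (m+[n∸m]≡n (<⇒≤ p<a)) (m∸n+n≡m (decreasing V 0)) (rearrange l p t (P 1) rest)

  state∈restrictedSumset : ∀ H as {P} → Linked _<_ (0 ∷ as) → Valid (length as) P → P 0 ∈ H →
    dot (length as) (gap 0 as) P ∈ restrictedSumset H r as
  state∈restrictedSumset H as sorted V P0∈H = ∈-concatMap⁺ (λ h → sumsList r h as) (lose P0∈H (state∈sumsList 0 as sorted V))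

-- Comparison of the chain length with 𝓛 over the integers.

open import Data.Integer as ℤ using (ℤ; +_)
import Data.Integer.Properties as ℤₚ
import Data.Integer.Tactic.RingSolver as ℤ-Solver

term : (K R m m′ e e′ x : ℤ) → ℤ
term K R m m′ e e′ x = R ℤ.* (m ℤ.- m′) ℤ.* (K ℤ.- m) ℤ.+ (e ℤ.- e′) ℤ.* (K ℤ.- m ℤ.- + 1) ℤ.- x ℤ.* (m ℤ.- m′) ℤ.+ + 1

-- Twice the weight of `low (q * r + ρ)`, see `weight-low`.
tri : (R q ρ : ℤ) → ℤ
tri R q ρ = (+ 1 ℤ.+ q) ℤ.* (q ℤ.* R ℤ.+ + 2 ℤ.* ρ)

-- Twice `1 + rise`: `u` and `v` are the values of `weight-top` at `h` and `hp`, while `X`, `Y` and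
-- `C` are twice the weights of `low` at `h`, `hp` and Δ.
balance : (u v X Y C : ℤ) → ℤ
balance u v X Y C = + 2 ℤ.+ + 2 ℤ.* u ℤ.- X ℤ.- (+ 2 ℤ.* v ℤ.- Y) ℤ.- C

balance-def : ∀ d b c x y → + 2 ℤ.* (+ 1 ℤ.+ d) ≡ balance (d ℤ.+ (b ℤ.+ c) ℤ.+ x) (b ℤ.+ y) (+ 2 ℤ.* x) (+ 2 ℤ.* y) (+ 2 ℤ.* c)
balance-def = expand
  where
  -- Definitions are written out so that the solver meets only ring operations.
  expand : ∀ d b c x y → + 2 ℤ.* (+ 1 ℤ.+ d) ≡
    + 2 ℤ.+ + 2 ℤ.* (d ℤ.+ (b ℤ.+ c) ℤ.+ x) ℤ.- + 2 ℤ.* x ℤ.- (+ 2 ℤ.* (b ℤ.+ y) ℤ.- + 2 ℤ.* y) ℤ.- + 2 ℤ.* c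
  expand = ℤ-Solver.solve-∀

-- If the remainder does not drop, Δ has quotient `q` and remainder `ρ`, and the chain matches the
-- term of 𝓛 exactly.
term-no-borrow : ∀ K R m′ q e′ ρ →
  balance ((+ 1 ℤ.+ K) ℤ.* ((m′ ℤ.+ q) ℤ.* R ℤ.+ (e′ ℤ.+ ρ))) ((+ 1 ℤ.+ K) ℤ.* (m′ ℤ.* R ℤ.+ e′))
          (tri R (m′ ℤ.+ q) (e′ ℤ.+ ρ)) (tri R m′ e′) (tri R q ρ)
  ≡ + 2 ℤ.* term K R (m′ ℤ.+ q) m′ (e′ ℤ.+ ρ) e′ (e′ ℤ.+ ρ)
term-no-borrow = expand
  where
  expand : ∀ K R m′ q e′ ρ →
    + 2 ℤ.+ + 2 ℤ.* ((+ 1 ℤ.+ K) ℤ.* ((m′ ℤ.+ q) ℤ.* R ℤ.+ (e′ ℤ.+ ρ))) ℤ.- (+ 1 ℤ.+ (m′ ℤ.+ q)) ℤ.* ((m′ ℤ.+ q) ℤ.* R ℤ.+ + 2 ℤ.* (e′ ℤ.+ ρ))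
    ℤ.- (+ 2 ℤ.* ((+ 1 ℤ.+ K) ℤ.* (m′ ℤ.* R ℤ.+ e′)) ℤ.- (+ 1 ℤ.+ m′) ℤ.* (m′ ℤ.* R ℤ.+ + 2 ℤ.* e′)) ℤ.- (+ 1 ℤ.+ q) ℤ.* (q ℤ.* R ℤ.+ + 2 ℤ.* ρ)
    ≡ + 2 ℤ.* (R ℤ.* (m′ ℤ.+ q ℤ.- m′) ℤ.* (K ℤ.- (m′ ℤ.+ q)) ℤ.+ (e′ ℤ.+ ρ ℤ.- e′) ℤ.* (K ℤ.- (m′ ℤ.+ q) ℤ.- + 1) ℤ.- (e′ ℤ.+ ρ) ℤ.* (m′ ℤ.+ q ℤ.- m′) ℤ.+ + 1)
  expand = ℤ-Solver.solve-∀

-- Here the chain is longer than the corresponding term of 𝓛 by q * s.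
term-borrow : ∀ K ρ s m′ q e →
  balance ((+ 1 ℤ.+ K) ℤ.* ((m′ ℤ.+ (+ 1 ℤ.+ q)) ℤ.* (ρ ℤ.+ s) ℤ.+ e)) ((+ 1 ℤ.+ K) ℤ.* (m′ ℤ.* (ρ ℤ.+ s) ℤ.+ (e ℤ.+ s)))
          (tri (ρ ℤ.+ s) (m′ ℤ.+ (+ 1 ℤ.+ q)) e) (tri (ρ ℤ.+ s) m′ (e ℤ.+ s)) (tri (ρ ℤ.+ s) q ρ)
  ≡ + 2 ℤ.* (term K (ρ ℤ.+ s) (m′ ℤ.+ (+ 1 ℤ.+ q)) m′ e (e ℤ.+ s) (e ℤ.+ s) ℤ.+ q ℤ.* s)
term-borrow = expand
  where
  expand : ∀ K ρ s m′ q e →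
    + 2 ℤ.+ + 2 ℤ.* ((+ 1 ℤ.+ K) ℤ.* ((m′ ℤ.+ (+ 1 ℤ.+ q)) ℤ.* (ρ ℤ.+ s) ℤ.+ e)) ℤ.- (+ 1 ℤ.+ (m′ ℤ.+ (+ 1 ℤ.+ q))) ℤ.* ((m′ ℤ.+ (+ 1 ℤ.+ q)) ℤ.* (ρ ℤ.+ s) ℤ.+ + 2 ℤ.* e)
    ℤ.- (+ 2 ℤ.* ((+ 1 ℤ.+ K) ℤ.* (m′ ℤ.* (ρ ℤ.+ s) ℤ.+ (e ℤ.+ s))) ℤ.- (+ 1 ℤ.+ m′) ℤ.* (m′ ℤ.* (ρ ℤ.+ s) ℤ.+ + 2 ℤ.* (e ℤ.+ s))) ℤ.- (+ 1 ℤ.+ q) ℤ.* (q ℤ.* (ρ ℤ.+ s) ℤ.+ + 2 ℤ.* ρ)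
    ≡ + 2 ℤ.* ((ρ ℤ.+ s) ℤ.* (m′ ℤ.+ (+ 1 ℤ.+ q) ℤ.- m′) ℤ.* (K ℤ.- (m′ ℤ.+ (+ 1 ℤ.+ q))) ℤ.+ (e ℤ.- (e ℤ.+ s)) ℤ.* (K ℤ.- (m′ ℤ.+ (+ 1 ℤ.+ q)) ℤ.- + 1)
             ℤ.- (e ℤ.+ s) ℤ.* (m′ ℤ.+ (+ 1 ℤ.+ q) ℤ.- m′) ℤ.+ + 1 ℤ.+ q ℤ.* s)
  expand = ℤ-Solver.solve-∀

balance-cong : ∀ {u u′ v v′ X X′ Y Y′ C C′} → u ≡ u′ → v ≡ v′ → X ≡ X′ → Y ≡ Y′ → C ≡ C′ →
               balance u v X Y C ≡ balance u′ v′ X′ Y′ C′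
balance-cong refl refl refl refl refl = refl

module Count (r : ℕ) (1≤r : 1 ≤ r) where
  open States r 1≤r
  open Weights r 1≤r

  +-weight-low : ∀ q n ρ → q < n → ρ ≤ r → + 2 ℤ.* + weight n (low (q * r + ρ)) ≡ tri (+ r) (+ q) (+ ρ)
  +-weight-low q n ρ q<n ρ≤r = begin
    + 2 ℤ.* + weight n (low (q * r + ρ))           ≡⟨ sym (ℤₚ.pos-* 2 (weight n (low (q * r + ρ)))) ⟩
    + (2 * weight n (low (q * r + ρ)))             ≡⟨ cong +_ (weight-low q n ρ q<n ρ≤r) ⟩
    + (suc q * (q * r + 2 * ρ))                    ≡⟨ ℤₚ.pos-* (suc q) (q * r + 2 * ρ) ⟩
    + suc q ℤ.* + (q * r + 2 * ρ)                  ≡⟨ cong₂ (λ x y → + suc q ℤ.* (x ℤ.+ y)) (ℤₚ.pos-* q r) (ℤₚ.pos-* 2 ρ) ⟩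
    tri (+ r) (+ q) (+ ρ)                          ∎
    where open ≡-Reasoning

  +-weight-top : ∀ n m e → m * r + e ≤ n * r →
    + weight n (top n (m * r + e)) ℤ.+ + weight n (low (m * r + e)) ≡ (+ 1 ℤ.+ + n) ℤ.* (+ m ℤ.* + r ℤ.+ + e)
  +-weight-top n m e h≤nr = begin
    + (weight n (top n (m * r + e)) + weight n (low (m * r + e)))  ≡⟨ cong +_ (weight-top n (m * r + e) h≤nr) ⟩
    + (suc n * (m * r + e))                                        ≡⟨ ℤₚ.pos-* (suc n) (m * r + e) ⟩
    + suc n ℤ.* + (m * r + e)                                      ≡⟨ cong (λ x → + suc n ℤ.* (x ℤ.+ + e)) (ℤₚ.pos-* m r) ⟩
    (+ 1 ℤ.+ + n) ℤ.* (+ m ℤ.* + r ℤ.+ + e)                        ∎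
    where open ≡-Reasoning

  balance-rise : ∀ n m e m′ e′ q ρ d → m < n → m′ < n → q < n → e ≤ r → e′ ≤ r → ρ ≤ r →
    d + (weight n (top n (m′ * r + e′)) + weight n (low (q * r + ρ))) ≡ weight n (top n (m * r + e)) →
    balance ((+ 1 ℤ.+ + n) ℤ.* (+ m ℤ.* + r ℤ.+ + e)) ((+ 1 ℤ.+ + n) ℤ.* (+ m′ ℤ.* + r ℤ.+ + e′))
            (tri (+ r) (+ m) (+ e)) (tri (+ r) (+ m′) (+ e′)) (tri (+ r) (+ q) (+ ρ)) ≡ + 2 ℤ.* + suc d
  balance-rise n m e m′ e′ q ρ d m<n m′<n q<n e≤r e′≤r ρ≤r eq = sym (trans
    (balance-def (+ d) (+ weight n (top n (m′ * r + e′))) (+ weight n (low (q * r + ρ)))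
                 (+ weight n (low (m * r + e))) (+ weight n (low (m′ * r + e′))))
    (balance-cong
      (trans (cong (λ x → + x ℤ.+ + weight n (low (m * r + e))) eq) (+-weight-top n m e (below m e m<n e≤r)))
      (+-weight-top n m′ e′ (below m′ e′ m′<n e′≤r))
      (+-weight-low m n e m<n e≤r) (+-weight-low m′ n e′ m′<n e′≤r) (+-weight-low q n ρ q<n ρ≤r)))
    where
    below : ∀ m e → m < n → e ≤ r → m * r + e ≤ n * r
    below m e m<n e≤r = ≤-trans (+-monoʳ-≤ (m * r) e≤r) (≤-trans (≤-reflexive (+-comm (m * r) r)) (*-monoˡ-≤ r m<n))

  no-borrow : ∀ n m′ q e′ ρ → e′ + ρ < r → m′ + q < suc n → (m′ + q) * r + (e′ + ρ) ≤ n * r →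
    term (+ suc n) (+ r) (+ (m′ + q)) (+ m′) (+ (e′ + ρ)) (+ e′) (+ (e′ + ρ ⊔ e′))
    ℤ.≤ + suc (rise (suc n) (m′ * r + e′) ((m′ + q) * r + (e′ + ρ)))
  no-borrow n m′ q e′ ρ e<r m<k h≤nr = subst
    (λ x → term (+ suc n) (+ r) (+ (m′ + q)) (+ m′) (+ (e′ + ρ)) (+ e′) (+ x) ℤ.≤ + suc d)
    (sym (m≥n⇒m⊔n≡m (m≤m+n e′ ρ)))
    (ℤₚ.≤-reflexive (ℤₚ.*-cancelˡ-≡ (+ 2) _ _ (trans
      (sym (term-no-borrow (+ suc n) (+ r) (+ m′) (+ q) (+ e′) (+ ρ)))
      (balance-rise (suc n) (m′ + q) (e′ + ρ) m′ e′ q ρ d m<k (≤-<-trans (m≤m+n m′ q) m<k) (≤-<-trans (m≤n+m q m′) m<k)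
        (<⇒≤ e<r) (≤-trans (m≤m+n e′ ρ) (<⇒≤ e<r)) (≤-trans (m≤n+m ρ e′) (<⇒≤ e<r)) d-eq))))
    where
    d : ℕ
    d = rise (suc n) (m′ * r + e′) ((m′ + q) * r + (e′ + ρ))
    split : ∀ m q r e ρ → m * r + e + (q * r + ρ) ≡ (m + q) * r + (e + ρ)
    split = solve-∀
    d-eq : d + (weight (suc n) (top (suc n) (m′ * r + e′)) + weight (suc n) (low (q * r + ρ))) ≡
           weight (suc n) (top (suc n) ((m′ + q) * r + (e′ + ρ)))
    d-eq = subst (λ x → rise (suc n) (m′ * r + e′) x + (weight (suc n) (top (suc n) (m′ * r + e′)) + weight (suc n) (low (q * r + ρ)))
                        ≡ weight (suc n) (top (suc n) x))
             (split m′ q r e′ ρ)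
             (rise-+ n (m′ * r + e′) (q * r + ρ) (≤-trans (≤-reflexive (split m′ q r e′ ρ)) h≤nr))

  -- The remainder drops by `s`, so Δ is `q * r + ρ` with `ρ = r - s`. Replacing `r` by `ρ + s`
  -- makes the comparison a polynomial identity; its surplus `q * s` is then discarded.
  borrow : ∀ n m′ q e s ρ → ρ + s ≡ r → e + s < r → m′ + suc q < suc n → (m′ + suc q) * r + e ≤ n * r →
    term (+ suc n) (+ r) (+ (m′ + suc q)) (+ m′) (+ e) (+ (e + s)) (+ (e ⊔ (e + s)))
    ℤ.≤ + suc (rise (suc n) (m′ * r + (e + s)) ((m′ + suc q) * r + e))
  borrow n m′ q e s ρ ρ+s≡r e′<r m<k h≤nr = subst
    (λ x → term (+ suc n) (+ r) (+ (m′ + suc q)) (+ m′) (+ e) (+ (e + s)) (+ x) ℤ.≤ + suc d)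
    (sym (m≤n⇒m⊔n≡n (m≤m+n e s)))
    (ℤₚ.≤-trans (ℤₚ.≤-trans (ℤₚ.i≤i+j _ (+ (q * s))) (ℤₚ.≤-reflexive (cong (λ x → t ℤ.+ x) (ℤₚ.pos-* q s))))
      (ℤₚ.≤-reflexive (ℤₚ.*-cancelˡ-≡ (+ 2) _ _ (trans doubled
      (balance-rise (suc n) (m′ + suc q) e m′ (e + s) q ρ d m<k (≤-<-trans (m≤m+n m′ (suc q)) m<k)
        (≤-<-trans (≤-trans (n≤1+n q) (m≤n+m (suc q) m′)) m<k)
        (≤-trans (m≤m+n e s) (<⇒≤ e′<r)) (<⇒≤ e′<r) (≤-trans (m≤m+n ρ s) (≤-reflexive ρ+s≡r)) d-eq)))))
    where
    d : ℕ
    d = rise (suc n) (m′ * r + (e + s)) ((m′ + suc q) * r + e)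
    t : ℤ
    t = term (+ suc n) (+ r) (+ (m′ + suc q)) (+ m′) (+ e) (+ (e + s)) (+ (e + s))
    doubled : + 2 ℤ.* (t ℤ.+ + q ℤ.* + s) ≡
      balance ((+ 1 ℤ.+ + suc n) ℤ.* (+ (m′ + suc q) ℤ.* + r ℤ.+ + e)) ((+ 1 ℤ.+ + suc n) ℤ.* (+ m′ ℤ.* + r ℤ.+ + (e + s)))
              (tri (+ r) (+ (m′ + suc q)) (+ e)) (tri (+ r) (+ m′) (+ (e + s))) (tri (+ r) (+ q) (+ ρ))
    doubled = subst (λ x →
      + 2 ℤ.* (term (+ suc n) (+ x) (+ (m′ + suc q)) (+ m′) (+ e) (+ (e + s)) (+ (e + s)) ℤ.+ + q ℤ.* + s) ≡
      balance ((+ 1 ℤ.+ + suc n) ℤ.* (+ (m′ + suc q) ℤ.* + x ℤ.+ + e)) ((+ 1 ℤ.+ + suc n) ℤ.* (+ m′ ℤ.* + x ℤ.+ + (e + s)))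
              (tri (+ x) (+ (m′ + suc q)) (+ e)) (tri (+ x) (+ m′) (+ (e + s))) (tri (+ x) (+ q) (+ ρ)))
      ρ+s≡r (sym (term-borrow (+ suc n) (+ ρ) (+ s) (+ m′) (+ q) (+ e)))
    split′ : ∀ m q e ρ s → m * (ρ + s) + (e + s) + (q * (ρ + s) + ρ) ≡ (m + suc q) * (ρ + s) + e
    split′ = solve-∀
    split : m′ * r + (e + s) + (q * r + ρ) ≡ (m′ + suc q) * r + e
    split = subst (λ x → m′ * x + (e + s) + (q * x + ρ) ≡ (m′ + suc q) * x + e) ρ+s≡r (split′ m′ q e ρ s)
    d-eq : d + (weight (suc n) (top (suc n) (m′ * r + (e + s))) + weight (suc n) (low (q * r + ρ))) ≡
           weight (suc n) (top (suc n) ((m′ + suc q) * r + e))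
    d-eq = subst (λ x → rise (suc n) (m′ * r + (e + s)) x + (weight (suc n) (top (suc n) (m′ * r + (e + s))) + weight (suc n) (low (q * r + ρ)))
                        ≡ weight (suc n) (top (suc n) x))
             split (rise-+ n (m′ * r + (e + s)) (q * r + ρ) (≤-trans (≤-reflexive split) h≤nr))

  term≤rise : ∀ n m e m′ e′ → e < r → e′ < r → m * r + e ≤ n * r → m′ * r + e′ < m * r + e →
    term (+ suc n) (+ r) (+ m) (+ m′) (+ e) (+ e′) (+ (e ⊔ e′)) ℤ.≤ + suc (rise (suc n) (m′ * r + e′) (m * r + e))
  term≤rise n m e m′ e′ e<r e′<r h≤nr hp<h = by-cases (e′ ≤? e)
    where
    goal : ℕ → ℕ → Set
    goal m e = term (+ suc n) (+ r) (+ m) (+ m′) (+ e) (+ e′) (+ (e ⊔ e′)) ℤ.≤ + suc (rise (suc n) (m′ * r + e′) (m * r + e))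

    m<k : m < suc n
    m<k = s≤s (*-cancelʳ-≤ m n r {{>-nonZero 1≤r}} (≤-trans (m≤m+n (m * r) e) h≤nr))

    m′≤m : m′ ≤ m
    m′≤m = ≤-pred (*-cancelʳ-< r m′ (suc m) (≤-<-trans (m≤m+n (m′ * r) e′)
             (<-trans hp<h (<-≤-trans (+-monoʳ-< (m * r) e<r) (≤-reflexive (+-comm (m * r) r))))))

    by-cases : Dec (e′ ≤ e) → goal m e
    by-cases (yes e′≤e) = go (m ∸ m′) (e ∸ e′) (m+[n∸m]≡n m′≤m) (m+[n∸m]≡n e′≤e) e<r m<k h≤nr
      where
      go : ∀ q ρ {m e} → m′ + q ≡ m → e′ + ρ ≡ e → e < r → m < suc n → m * r + e ≤ n * r → goal m e
      go q ρ refl refl = no-borrow n m′ q e′ ρ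
    by-cases (no e′≰e) = go (m ∸ suc m′) (e′ ∸ e) (trans (+-suc m′ _) (m+[n∸m]≡n m′<m)) (m+[n∸m]≡n (≰⇒≥ e′≰e)) e′<r m<k h≤nr
      where
      m′<m : m′ < m
      -- With equal quotients, `hp < h` would force the remainder to grow.
      m′<m = ≤∧≢⇒< m′≤m λ { refl → <-asym (≰⇒> e′≰e) (+-cancelˡ-< (m * r) e′ e hp<h) }
      go : ∀ q s {m e′} → m′ + suc q ≡ m → e + s ≡ e′ → e′ < r → m < suc n → m * r + e ≤ n * r →
           term (+ suc n) (+ r) (+ m) (+ m′) (+ e) (+ e′) (+ (e ⊔ e′)) ℤ.≤ + suc (rise (suc n) (m′ * r + e′) (m * r + e))
      go q s refl refl e′<r = borrow n m′ q e s (r ∸ s) (m∸n+n≡m (≤-trans (m≤n+m s e) (<⇒≤ e′<r))) e′<r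

  Lterm≤rise : ∀ n hp h .{{_ : NonZero r}} → h ≤ n * r → hp < h → Lterm (suc n) r hp h ℤ.≤ + suc (rise (suc n) hp h)
  Lterm≤rise n hp h h≤nr hp<h = subst₂
    (λ x y → Lterm (suc n) r hp h ℤ.≤ + suc (rise (suc n) x y)) (sym (div hp)) (sym (div h))
    (term≤rise n (h / r) (h % r) (hp / r) (hp % r) (m%n<n h r) (m%n<n hp r)
      (subst (_≤ n * r) (div h) h≤nr) (subst₂ _<_ (div hp) (div h) hp<h))
    where
    div : ∀ x → x ≡ x / r * r + x % r
    div x = trans (m≡m%n+[m/n]*n x r) (+-comm (x % r) (x / r * r))

  Lsum≤climbs : ∀ n hp hs .{{_ : NonZero r}} → All (_≤ n * r) hs → Linked _<_ (hp ∷ hs) →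
                Lsum (suc n) r hp hs ℤ.≤ + climbs n hp hs
  Lsum≤climbs n hp []       []           _              = ℤₚ.≤-refl
  Lsum≤climbs n hp (h ∷ hs) (h≤nr ∷ hs≤) (hp<h ∷ sorted) =
    ℤₚ.+-mono-≤ (Lterm≤rise n hp h h≤nr hp<h) (Lsum≤climbs n h hs hs≤ sorted)

theorem3p1 : (r k : ℕ) .{{_ : NonZero r}} (A H : List ℕ) →
    Linked _<_ A → All (λ a → 1 ≤ a) A → length A ≡ k → 6 ≤ k →
    Linked _<_ H → All (λ h → 1 ≤ h) H → 2 ≤ length H →
    1 ≤ r → r ≤ listMax H → listMax H ≤ (k ∸ 1) * r ∸ 1 →
    + card (restrictedSumset H r A) ≡ 𝓛 k H r →
    ∃[ d ] (d ≤ r × IsAP d H × IsAP (d * listMin A) A)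
theorem3p1 r _ []       _        _ _         refl () _ _ _ _ _ _ _
theorem3p1 r _ (a ∷ as) []       _ _         _    _  _ _ () _ _ _ _
theorem3p1 r _ (a ∷ as) (_ ∷ []) _ _         _    _  _ _ (s≤s ()) _ _ _ _
theorem3p1 r _ (a ∷ as) H@(h₁ ∷ h₂ ∷ hs) sortedA (1≤a ∷ _) refl (s≤s 5≤k′) sortedH 1≤H@(1≤h₁ ∷ _) _ 1≤r _ max≤ eq =
  conclude (structure (≤-trans (s≤s (s≤s (s≤s z≤n))) 5≤k′) h₁ h₂ hs 1≤h₁ sortedH admissible few)
  where
  k′ : ℕ
  k′ = length as
  sorted₀ : Linked _<_ (0 ∷ a ∷ as)
  sorted₀ = 1≤a ∷ sortedA
  T : List ℕ
  T = restrictedSumset H r (a ∷ as)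
  open Extremal r 1≤r k′ (gap 0 (a ∷ as)) (gap-pos sorted₀) H T (Sums.state∈restrictedSumset r 1≤r H (a ∷ as) sorted₀)
  open Weights r 1≤r using (climbs)

  below : All (_< k′ * r) H
  -- The truncated `∸ 1` gives a strict bound because `k′ * r` is positive.
  below = All.map (λ h≤ → ≤-<-trans (≤-trans h≤ max≤) (∸-monoʳ-< (s≤s z≤n) (*-mono-≤ (≤-trans (s≤s z≤n) 5≤k′) 1≤r))) (≤-listMax H)

  admissible : All Admissible H
  admissible = All.zip (All.tabulate id , below)

  few : card T ≤ climbs k′ 0 H
  -- The assumed cardinality enters here; `1≤h₁` supplies `h₀ = 0 < h₁`.
  few = ℤₚ.drop‿+≤+ (ℤₚ.≤-trans (ℤₚ.≤-reflexive eq) (Count.Lsum≤climbs r 1≤r k′ 0 H (All.map <⇒≤ below) (1≤h₁ ∷ sortedH)))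

  conclude : ∃[ d ] (d ≤ r × Linked (λ x y → y ≡ x + d) H × (∀ j → suc j < suc k′ → gap a as j ≡ a * d)) →
             ∃[ d ] (d ≤ r × IsAP d H × IsAP (d * listMin (a ∷ as)) (a ∷ as))
  conclude (d , d≤r , steps , gaps) = d , d≤r , constant-step⇒IsAP steps ,
    constant-step⇒IsAP (equal-gaps sortedA λ j j<k′ →
      trans (gaps j (s≤s j<k′)) (trans (*-comm a d) (cong (λ x → d * x) (sym (listMin-sorted sortedA)))))
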